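{- For all $n$ and all $p\in[1,n^{2-o(1)}]$, $$\texttt{DSFG}(n,p)=\Omega\left(\frac{\beta(n,p,\infty)}{n^{3/2}}\right).$$ In particular, $\texttt{DSFG}(n,n^{2-o(1)})=\Omega(n^{1/2-o(1)})$.
   Context: A path system is a pair $(V,\Pi)$ with $V$ a finite node set and $\Pi$ a finite multiset of paths, each a finite sequence of pairwise distinct nodes; the size is $\sum_{\pi\in\Pi}|\pi|$ where $|\pi|$ is the number of nodes. A $b$-bridge consists of $b$ distinct nodes $v_1,\dots,v_b$ and $b$ distinct paths $\pi_1,\dots,\pi_b$ with $v_i$ preceding $v_{i+1}$ on $\pi_i$ for $1\le i\le b-1$ and $v_1$ preceding $v_b$ on $\pi_b$. $\beta(n,p,\infty)$ is the maximum size of a path system with $n$ nodes, $p$ paths and no bridges. In the Directed Steiner Forest problem one is given a directed graph $G=(V,E,w)$ with nonnegative edge weights and demand pairs $P\subseteq V\times V$, and seeks a subgraph $H$ of minimum total weight containing a directed $s\leadsto t$ path for every $(s,t)\in P$; $\textsc{DSF}(G,P)$ denotes this minimum. Its flow LP relaxation $\widehat{\textsc{DSF}}(G,P)$ is the minimum of $\sum_{e\in E}w_ex_e$ over $x_e\ge0$ such that, for each $(s,t)\in P$ separately, the edge capacities $\{x_e\}$ support an $s$-$t$ flow of value $1$. $\texttt{DSFG}(n,p)$ is the least integer $k$ such that for every $n$-node weighted directed graph $G$ and every set $P$ of $p$ demand pairs, $\textsc{DSF}(G,P)\le k\cdot\widehat{\textsc{DSF}}(G,P)$. -}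

module Defs where

open import Data.Nat as ℕ using (ℕ; zero; suc)
open import Data.Integer as ℤ using (ℤ)
open import Data.Rational as ℚ using (ℚ; 0ℚ; 1ℚ)
open import Data.Fin using (Fin; zero; suc; inject₁; fromℕ)
open import Data.List using (List; []; _∷_; _++_; length)
open import Data.List.Relation.Unary.Unique.Propositional using (Unique)
open import Data.Product using (Σ; ∃; _×_; _,_)
open import Data.Sum using (_⊎_)
open import Data.Bool using (Bool; true; false)
open import Function.Definitions using (Injective)
open import Relation.Binary.PropositionalEquality using (_≡_; _≢_)

ℕ→ℚ : ℕ → ℚ
ℕ→ℚ n = ℤ.+ n ℚ./ 1

sumℕ : ∀ {m} → (Fin m → ℕ) → ℕ
sumℕ {zero}  f = 0
sumℕ {suc m} f = f zero ℕ.+ sumℕ (λ i → f (suc i))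

sumℚ : ∀ {m} → (Fin m → ℚ) → ℚ
sumℚ {zero}  f = 0ℚ
sumℚ {suc m} f = f zero ℚ.+ sumℚ (λ i → f (suc i))

Precedes : ∀ {A : Set} → A → A → List A → Set
Precedes {A} u w l =
  Σ (List A) λ xs → Σ (List A) λ ys → Σ (List A) λ zs →
    l ≡ xs ++ (u ∷ ys ++ (w ∷ zs))

-- A path system on node set Fin n with a multiset of p paths
-- (indexed by Fin p; repeated paths allowed).
record PathSystem (n p : ℕ) : Set where
  field
    path     : Fin p → List (Fin n)
    distinct : ∀ i → Unique (path i)
open PathSystem public

size : ∀ {n p} → PathSystem n p → ℕ
size S = sumℕ (λ i → length (path S i))

-- A b-bridge with b = suc k: nodes v_1..v_b (v : Fin b → Fin n,
-- pairwise distinct) and paths π_1..π_b (π : Fin b → Fin p, pairwise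
-- distinct members of the multiset) with v_i before v_{i+1} on π_i
-- (1 ≤ i ≤ b-1) and v_1 before v_b on π_b.
record Bridge {n p : ℕ} (S : PathSystem n p) (k : ℕ) : Set where
  field
    v     : Fin (suc k) → Fin n
    π     : Fin (suc k) → Fin p
    v-inj : Injective _≡_ _≡_ v
    π-inj : Injective _≡_ _≡_ π
    chain : ∀ (i : Fin k) →
              Precedes (v (inject₁ i)) (v (suc i)) (path S (π (inject₁ i)))
    close : Precedes (v zero) (v (fromℕ k)) (path S (π (fromℕ k)))

BridgeFree : ∀ {n p} → PathSystem n p → Set
BridgeFree S = ∀ k → Bridge S k → Data.Empty.⊥
  where import Data.Empty

IsBeta : ℕ → ℕ → ℕ → Set
IsBeta n p b =
  (Σ (PathSystem n p) λ S → BridgeFree S × size S ≡ b) ×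
  (∀ (S : PathSystem n p) → BridgeFree S → size S ℕ.≤ b)

record WDigraph (n : ℕ) : Set where
  field
    m      : ℕ
    src    : Fin m → Fin n
    tgt    : Fin m → Fin n
    weight : Fin m → ℚ
    weight-nonneg : ∀ e → 0ℚ ℚ.≤ weight e
open WDigraph public

Subgraph : ∀ {n} → WDigraph n → Set
Subgraph G = Fin (m G) → Bool

subWeight : ∀ {n} (G : WDigraph n) → Subgraph G → ℚ
subWeight G H = sumℚ (λ e → if H e then weight G e else 0ℚ)
  where open Data.Bool using (if_then_else_)

data Reach {n} (G : WDigraph n) (H : Subgraph G) : Fin n → Fin n → Set where
  here : ∀ {s} → Reach G H s s
  step : ∀ {t} (e : Fin (m G)) → H e ≡ true →
         Reach G H (tgt G e) t → Reach G H (src G e) t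

-- demand pairs: a set (list without repetitions) of pairs
Demands : ℕ → Set
Demands n = List (Fin n × Fin n)

data All {A : Set} (P : A → Set) : List A → Set where
  []  : All P []
  _∷_ : ∀ {x xs} → P x → All P xs → All P (x ∷ xs)

Feasible : ∀ {n} (G : WDigraph n) → Demands n → Subgraph G → Set
Feasible G P H = All (λ { (s , t) → Reach G H s t }) P

IsDSF : ∀ {n} (G : WDigraph n) → Demands n → ℚ → Set
IsDSF G P v =
  (Σ (Subgraph G) λ H → Feasible G P H × subWeight G H ≡ v) ×
  (∀ H → Feasible G P H → v ℚ.≤ subWeight G H)

inflow outflow : ∀ {n} (G : WDigraph n) → (Fin (m G) → ℚ) → Fin n → ℚ
inflow  G f u = sumℚ (λ e → if ⌊ tgt G e Data.Fin.≟ u ⌋ then f e else 0ℚ)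
  where open Data.Bool using (if_then_else_)
        open import Relation.Nullary.Decidable using (⌊_⌋)
        import Data.Fin
outflow G f u = sumℚ (λ e → if ⌊ src G e Data.Fin.≟ u ⌋ then f e else 0ℚ)
  where open Data.Bool using (if_then_else_)
        open import Relation.Nullary.Decidable using (⌊_⌋)
        import Data.Fin

IsUnitFlow : ∀ {n} (G : WDigraph n) → (Fin (m G) → ℚ) →
             Fin n → Fin n → (Fin (m G) → ℚ) → Set
IsUnitFlow G x s t f =
  (∀ e → 0ℚ ℚ.≤ f e) × (∀ e → f e ℚ.≤ x e) ×
  (∀ u → u ≢ s → u ≢ t → inflow G f u ≡ outflow G f u) ×
  (outflow G f s ℚ.- inflow G f s ≡ 1ℚ)

-- capacities x support an s-t flow of value 1
-- (convention: a pair (s,s) is trivially satisfied)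
SupportsFlow : ∀ {n} (G : WDigraph n) → (Fin (m G) → ℚ) → Fin n → Fin n → Set
SupportsFlow G x s t = s ≡ t ⊎ Σ (Fin (m G) → ℚ) (IsUnitFlow G x s t)

LPFeasible : ∀ {n} (G : WDigraph n) → Demands n → (Fin (m G) → ℚ) → Set
LPFeasible G P x =
  (∀ e → 0ℚ ℚ.≤ x e) × All (λ { (s , t) → SupportsFlow G x s t }) P

LPCost : ∀ {n} (G : WDigraph n) → (Fin (m G) → ℚ) → ℚ
LPCost G x = sumℚ (λ e → weight G e ℚ.* x e)

-- k satisfies DSF(G,P) ≤ k · \hat{DSF}(G,P) for all n-node G and all
-- sets P of p demand pairs.  Since \hat{DSF} is a minimum over feasible
-- x, this is: DSF(G,P) ≤ k · cost(x) for every LP-feasible x.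
GapBound : ℕ → ℕ → ℕ → Set
GapBound n p k =
  ∀ (G : WDigraph n) (P : Demands n) → Unique P → length P ≡ p →
  ∀ (x : Fin (m G) → ℚ) → LPFeasible G P x →
  ∀ v → IsDSF G P v → v ℚ.≤ ℕ→ℚ k ℚ.* LPCost G x

IsDSFG : ℕ → ℕ → ℕ → Set
IsDSFG n p k = GapBound n p k × (∀ j → GapBound n p j → k ℕ.≤ j)

{-# OPTIONS --safe #-}

-- A bipartite graph on K + K nodes that is the union of p matchings of size σ, each induced in
-- the union, yields a Steiner forest instance: give every node weight 1 and demand, for every
-- matching, a connection from a source joined to its left ends to a sink fed by its right ends.
-- As the matching is induced, a solution must buy both ends of one of its edges, so the product of
-- the numbers of nodes bought on the two sides is at least p and the cost at least 2√p, whereas the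
-- LP spreads 1/σ over every node at cost 2K/σ: the gap is at least √p σ / K.  Behrend's
-- construction makes p = σ = K^{1-o(1)}, and further demands can be added for free.  On the other
-- side, in a path system without 2-bridges every ordered pair of nodes lies on at most one path,
-- whence β² ≤ 4n²p for p ≤ n²; up to R n = n · gap² demands, this is at most 4n³ · gap².

module Submission where

open import Defs
open import Data.Nat as ℕ using (ℕ; zero; suc; _+_; _*_; _^_; _∸_; _≤_; _<_; _≤?_; z≤n; s≤s; NonZero)
open import Data.Nat.Properties
open import Data.Nat.Induction using (<-rec)
open import Data.Nat.Tactic.RingSolver using (solve-∀)
open import Data.Integer as ℤ using ()
import Data.Integer.Properties as ℤ
open import Data.Rational as ℚ using (ℚ; 0ℚ; 1ℚ; ½)
import Data.Rational.Properties as ℚ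
open import Data.Rational.Unnormalised as ℚᵘ using (mkℚᵘ; *≡*; *≤*)
import Data.Rational.Unnormalised.Properties as ℚᵘ
open import Data.Fin as Fin using (Fin; zero; suc; toℕ; fromℕ<; _↑ˡ_; _↑ʳ_; splitAt; combine; remQuot; inject≤; finToFun; funToFin)
import Data.Fin.Properties as Fin
open import Data.Bool using (Bool; true; false; if_then_else_)
open import Data.List using (List; []; _∷_; _++_; length; tabulate; map; concat; lookup)
open import Data.List.Properties using (length-++; length-map; length-tabulate)
open import Data.List.Membership.Propositional using (_∈_)
open import Data.List.Membership.Propositional.Properties using (∈-tabulate⁻; ∈-map⁻; ∈-++⁻; ∈-∃++; ∈-lookup)
open import Data.List.Relation.Unary.Any using (here; there)
import Data.List.Relation.Unary.All as List
import Data.List.Relation.Unary.All.Properties as List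
open import Data.List.Relation.Unary.AllPairs using ([]; _∷_)
import Data.List.Relation.Unary.AllPairs.Properties as AllPairs
open import Data.List.Relation.Unary.Unique.Propositional using (Unique)
import Data.List.Relation.Unary.Unique.Propositional.Properties as Unique
open import Data.Product using (Σ; _×_; _,_; proj₁; proj₂)
open import Data.Product.Properties using (,-injectiveˡ; ,-injectiveʳ)
open import Data.Sum using (_⊎_; inj₁; inj₂; [_,_]′)
open import Data.Unit using (⊤; tt)
open import Data.Empty using (⊥; ⊥-elim)
open import Relation.Nullary using (yes; no)
open import Relation.Nullary.Decidable using (⌊_⌋; decidable-stable; from-yes)
open import Relation.Binary.PropositionalEquality using (_≡_; _≢_; refl; sym; trans; cong; cong₂; subst; subst₂; module ≡-Reasoning)

-- With p = σ the squared gap is σ (σ / K)², so the construction is good when K exceeds σ by a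
-- subpolynomial factor only. Vectors of m digits below 2^m give p = σ = 2^(m²) and K = 2^(m² + 5m),
-- hence a squared gap of at least 2^(m² - 10m) as soon as there are 2^(m² + 5m + 3) nodes; the
-- linear terms are negligible against m², whence the exponents 1 - o(1). Taking every quantity to
-- be a power of two reduces the estimates to polynomial inequalities in m. No square root is ever
-- formed: n^(3/2) and the gap enter through their squares, and the constant 1/2 comes from β² ≤
-- 4k²n³. The number of demands falls into two regimes. Up to n of them, β² ≤ 4n²p is at most 4n³
-- and a gap of at least 1 is enough. Beyond n, the instance contributes fewer demands than required
-- and the rest is padding. The padding could go further, but β² ≤ 4n²p compares with n³ · gap² only
-- while p ≤ n · gap²; this fixes the range `R`.

-- Here k is the distance of a and b. Keeping the defect k² yields both the inequality 2ab ≤ a² + b²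
-- and its equality case, which the sphere argument needs.
a²+b²≡2ab+k² : ∀ a b → Σ ℕ λ k → 2 * (a * b) + k * k ≡ a * a + b * b × (k ≡ 0 → a ≡ b)
a²+b²≡2ab+k² a b with ≤-total a b
... | inj₁ a≤b with k , refl ← m≤n⇒∃[o]m+o≡n a≤b = k , eq a k , λ { refl → sym (+-identityʳ a) }
  where
  eq : ∀ a k → 2 * (a * (a + k)) + k * k ≡ a * a + (a + k) * (a + k)
  eq = solve-∀
... | inj₂ b≤a with k , refl ← m≤n⇒∃[o]m+o≡n b≤a = k , eq b k , λ { refl → +-identityʳ b }
  where
  eq : ∀ b k → 2 * ((b + k) * b) + k * k ≡ (b + k) * (b + k) + b * b
  eq = solve-∀

2ab≤a²+b² : ∀ a b → 2 * (a * b) ≤ a * a + b * b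
2ab≤a²+b² a b with k , e , _ ← a²+b²≡2ab+k² a b = ≤-trans (m≤m+n _ (k * k)) (≤-reflexive e)

2ab≡a²+b²⇒a≡b : ∀ a b → 2 * (a * b) ≡ a * a + b * b → a ≡ b
2ab≡a²+b²⇒a≡b a b e with k , e′ , z ← a²+b²≡2ab+k² a b =
  z ([ (λ x → x) , (λ x → x) ]′ (m*n≡0⇒m≡0∨n≡0 k (+-cancelˡ-≡ (2 * (a * b)) (k * k) 0
    (trans e′ (trans (sym e) (sym (+-identityʳ _)))))))

4ab≤[a+b]² : ∀ a b → 4 * (a * b) ≤ (a + b) * (a + b)
4ab≤[a+b]² a b = begin
  4 * (a * b)                       ≡⟨ split (a * b) ⟩
  2 * (a * b) + 2 * (a * b)         ≤⟨ +-monoʳ-≤ (2 * (a * b)) (2ab≤a²+b² a b) ⟩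
  2 * (a * b) + (a * a + b * b)     ≡⟨ square a b ⟩
  (a + b) * (a + b)                 ∎
  where
  open ≤-Reasoning
  split : ∀ c → 4 * c ≡ 2 * c + 2 * c
  split = solve-∀
  square : ∀ a b → 2 * (a * b) + (a * a + b * b) ≡ (a + b) * (a + b)
  square = solve-∀

-- Finite sums and their embedding into ℚ

sum-cong : ∀ {m} {f g : Fin m → ℕ} → (∀ i → f i ≡ g i) → sumℕ f ≡ sumℕ g
sum-cong {zero}  h = refl
sum-cong {suc m} h = cong₂ _+_ (h zero) (sum-cong (λ i → h (suc i)))

sum-mono : ∀ {m} {f g : Fin m → ℕ} → (∀ i → f i ≤ g i) → sumℕ f ≤ sumℕ g
sum-mono {zero}  h = z≤n
sum-mono {suc m} h = +-mono-≤ (h zero) (sum-mono (λ i → h (suc i)))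

sum-const : ∀ m c → sumℕ {m} (λ _ → c) ≡ m * c
sum-const zero    c = refl
sum-const (suc m) c = cong (c +_) (sum-const m c)

sum-zero : ∀ {m} {f : Fin m → ℕ} → (∀ i → f i ≡ 0) → sumℕ f ≡ 0
sum-zero {m} h = trans (sum-cong h) (trans (sum-const m 0) (*-zeroʳ m))

sum-+ : ∀ {m} (f g : Fin m → ℕ) → sumℕ (λ i → f i + g i) ≡ sumℕ f + sumℕ g
sum-+ {zero}  f g = refl
sum-+ {suc m} f g = trans (cong (f zero + g zero +_) (sum-+ (λ i → f (suc i)) (λ i → g (suc i))))
  (interchange (f zero) (g zero) _ _)
  where
  interchange : ∀ a b c d → (a + b) + (c + d) ≡ (a + c) + (b + d)
  interchange = solve-∀

sum-*ˡ : ∀ {m} c (f : Fin m → ℕ) → sumℕ (λ i → c * f i) ≡ c * sumℕ f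
sum-*ˡ {zero}  c f = sym (*-zeroʳ c)
sum-*ˡ {suc m} c f = trans (cong (c * f zero +_) (sum-*ˡ c (λ i → f (suc i))))
  (sym (*-distribˡ-+ c (f zero) _))

sum-swap : ∀ {m n} (f : Fin m → Fin n → ℕ) →
           sumℕ (λ i → sumℕ (f i)) ≡ sumℕ (λ j → sumℕ (λ i → f i j))
sum-swap {zero}  {n} f = sym (sum-zero {n} (λ _ → refl))
sum-swap {suc m} f = trans (cong (sumℕ (f zero) +_) (sum-swap (λ i → f (suc i))))
  (sym (sum-+ (f zero) (λ j → sumℕ (λ i → f (suc i) j))))

sum-split : ∀ m {n} (f : Fin (m + n) → ℕ) →
            sumℕ f ≡ sumℕ (λ i → f (i ↑ˡ n)) + sumℕ (λ j → f (m ↑ʳ j))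
sum-split zero    f = refl
sum-split (suc m) f = trans (cong (f zero +_) (sum-split m (λ i → f (suc i))))
  (sym (+-assoc (f zero) _ _))

sum-≤-≡ : ∀ {m} {f g : Fin m → ℕ} → (∀ i → f i ≤ g i) → sumℕ g ≤ sumℕ f → ∀ i → f i ≡ g i
sum-≤-≡ {suc m} {f} {g} h le zero = ≤-antisym (h zero)
  (+-cancelʳ-≤ (sumℕ (λ i → f (suc i))) _ _
    (≤-trans (+-monoʳ-≤ (g zero) (sum-mono (λ i → h (suc i)))) le))
sum-≤-≡ {suc m} {f} {g} h le (suc i) = sum-≤-≡ (λ i → h (suc i))
  (+-cancelˡ-≤ (f zero) _ _ (≤-trans (+-monoˡ-≤ _ (h zero)) le)) i

-- The same test as in `inflow` and `outflow`, with values in ℕ: flow conservation can be proved for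
-- natural numbers and scaled afterwards.
δ : ∀ {n} → Fin n → Fin n → ℕ
δ i j = if ⌊ i Fin.≟ j ⌋ then 1 else 0

δ-refl : ∀ {n} (i : Fin n) → δ i i ≡ 1
δ-refl i with i Fin.≟ i
... | yes _ = refl
... | no ¬p = ⊥-elim (¬p refl)

δ-≢ : ∀ {n} {i j : Fin n} → i ≢ j → δ i j ≡ 0
δ-≢ {i = i} {j} i≢j with i Fin.≟ j
... | yes p = ⊥-elim (i≢j p)
... | no _  = refl

δ≤1 : ∀ {n} (i j : Fin n) → δ i j ≤ 1
δ≤1 i j with i Fin.≟ j
... | yes _ = ≤-refl
... | no _  = z≤n

δ-suc : ∀ {n} (i j : Fin n) → δ (suc i) (suc j) ≡ δ i j
δ-suc i j with i Fin.≟ j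
... | yes _ = refl
... | no _  = refl

sum-*δ : ∀ {m} (h : Fin m → ℕ) (j : Fin m) → sumℕ (λ i → h i * δ i j) ≡ h j
sum-*δ {suc m} h zero = trans (cong₂ _+_ (*-identityʳ (h zero)) (sum-zero (λ i → *-zeroʳ (h (suc i)))))
  (+-identityʳ (h zero))
sum-*δ {suc m} h (suc j) = trans
  (cong₂ _+_ (*-zeroʳ (h zero)) (sum-cong (λ i → cong (h (suc i) *_) (δ-suc i j))))
  (sum-*δ (λ i → h (suc i)) j)

sum-δ-injective : ∀ {m n} (f : Fin m → Fin n) → (∀ {u v} → f u ≡ f v → u ≡ v) →
                  ∀ i → sumℕ (λ u → δ i (f u)) ≤ 1
sum-δ-injective {zero}  f inj i = z≤n
sum-δ-injective {suc m} f inj i with i Fin.≟ f zero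
... | yes refl = s≤s (≤-reflexive (sum-zero {m} {λ u → δ (f zero) (f (suc u))}
    (λ u → δ-≢ (λ e → 0≢suc (inj e)))))
  where
  0≢suc : ∀ {n} {u : Fin n} → Fin.zero ≢ suc u
  0≢suc ()
... | no _ = sum-δ-injective (λ u → f (suc u)) (λ e → Fin.suc-injective (inj e)) i

ℕ→ℚᵘ : ∀ n → ℚ.toℚᵘ (ℕ→ℚ n) ℚᵘ.≃ mkℚᵘ (ℤ.+ n) 0
ℕ→ℚᵘ n = ℚ.toℚᵘ-fromℚᵘ (mkℚᵘ (ℤ.+ n) 0)

ℕ→ℚ-+ : ∀ a b → ℕ→ℚ (a + b) ≡ ℕ→ℚ a ℚ.+ ℕ→ℚ b
ℕ→ℚ-+ a b = ℚ.toℚᵘ-injective (ℚᵘ.≃-trans (ℕ→ℚᵘ (a + b)) (ℚᵘ.≃-sym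
  (ℚᵘ.≃-trans (ℚ.toℚᵘ-homo-+ (ℕ→ℚ a) (ℕ→ℚ b)) (ℚᵘ.≃-trans (ℚᵘ.+-cong (ℕ→ℚᵘ a) (ℕ→ℚᵘ b))
    (*≡* (cong (ℤ._* ℤ.+ 1) (cong₂ ℤ._+_ (ℤ.*-identityʳ (ℤ.+ a)) (ℤ.*-identityʳ (ℤ.+ b)))))))))

ℕ→ℚ-* : ∀ a b → ℕ→ℚ (a * b) ≡ ℕ→ℚ a ℚ.* ℕ→ℚ b
ℕ→ℚ-* a b = ℚ.toℚᵘ-injective (ℚᵘ.≃-trans (ℕ→ℚᵘ (a * b)) (ℚᵘ.≃-sym
  (ℚᵘ.≃-trans (ℚ.toℚᵘ-homo-* (ℕ→ℚ a) (ℕ→ℚ b)) (ℚᵘ.≃-trans (ℚᵘ.*-cong (ℕ→ℚᵘ a) (ℕ→ℚᵘ b))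
    (*≡* (cong (ℤ._* ℤ.+ 1) (sym (ℤ.pos-* a b))))))))

ℕ→ℚ-mono : ∀ {a b} → a ≤ b → ℕ→ℚ a ℚ.≤ ℕ→ℚ b
ℕ→ℚ-mono {a} {b} a≤b = ℚ.toℚᵘ-cancel-≤ (ℚᵘ.≤-respˡ-≃ (ℚᵘ.≃-sym (ℕ→ℚᵘ a))
  (ℚᵘ.≤-respʳ-≃ (ℚᵘ.≃-sym (ℕ→ℚᵘ b)) (*≤* (ℤ.*-monoʳ-≤-nonNeg (ℤ.+ 1) (ℤ.+≤+ a≤b)))))

ℕ→ℚ-cancel-≤ : ∀ {a b} → ℕ→ℚ a ℚ.≤ ℕ→ℚ b → a ≤ b
ℕ→ℚ-cancel-≤ {a} {b} le with ℚᵘ.≤-respˡ-≃ (ℕ→ℚᵘ a) (ℚᵘ.≤-respʳ-≃ (ℕ→ℚᵘ b) (ℚ.toℚᵘ-mono-≤ le))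
... | *≤* p = ℤ.drop‿+≤+ (ℤ.*-cancelʳ-≤-pos (ℤ.+ a) (ℤ.+ b) (ℤ.+ 1) p)

0≤ℕ→ℚ : ∀ n → 0ℚ ℚ.≤ ℕ→ℚ n
0≤ℕ→ℚ n = ℕ→ℚ-mono {0} {n} z≤n

sumℚ-cong : ∀ {m} {f g : Fin m → ℚ} → (∀ i → f i ≡ g i) → sumℚ f ≡ sumℚ g
sumℚ-cong {zero}  h = refl
sumℚ-cong {suc m} h = cong₂ ℚ._+_ (h zero) (sumℚ-cong (λ i → h (suc i)))

sumℚ-scaled : ∀ {m} (f : Fin m → ℕ) r → sumℚ (λ i → ℕ→ℚ (f i) ℚ.* r) ≡ ℕ→ℚ (sumℕ f) ℚ.* r
sumℚ-scaled {zero}  f r = sym (ℚ.*-zeroˡ r)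
sumℚ-scaled {suc m} f r = begin
  ℕ→ℚ (f zero) ℚ.* r ℚ.+ sumℚ (λ i → ℕ→ℚ (f (suc i)) ℚ.* r)
    ≡⟨ cong (ℕ→ℚ (f zero) ℚ.* r ℚ.+_) (sumℚ-scaled (λ i → f (suc i)) r) ⟩
  ℕ→ℚ (f zero) ℚ.* r ℚ.+ ℕ→ℚ (sumℕ (λ i → f (suc i))) ℚ.* r
    ≡⟨ ℚ.*-distribʳ-+ r (ℕ→ℚ (f zero)) _ ⟨
  (ℕ→ℚ (f zero) ℚ.+ ℕ→ℚ (sumℕ (λ i → f (suc i)))) ℚ.* r
    ≡⟨ cong (ℚ._* r) (ℕ→ℚ-+ (f zero) _) ⟨
  ℕ→ℚ (sumℕ f) ℚ.* r ∎
  where open ≡-Reasoning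

sumℚ-ℕ→ℚ : ∀ {m} (f : Fin m → ℕ) → sumℚ (λ i → ℕ→ℚ (f i)) ≡ ℕ→ℚ (sumℕ f)
sumℚ-ℕ→ℚ f = trans (sumℚ-cong (λ i → sym (ℚ.*-identityʳ (ℕ→ℚ (f i)))))
  (trans (sumℚ-scaled f 1ℚ) (ℚ.*-identityʳ _))

1/[_] : ∀ n .{{_ : NonZero n}} → ℚ
1/[ n ] = ℤ.+ 1 ℚ./ n

n*1/n≡1 : ∀ n .{{_ : NonZero n}} → ℕ→ℚ n ℚ.* 1/[ n ] ≡ 1ℚ
n*1/n≡1 (suc n) = ℚ.toℚᵘ-injective (ℚᵘ.≃-trans (ℚ.toℚᵘ-homo-* (ℕ→ℚ (suc n)) 1/[ suc n ])
  (ℚᵘ.≃-trans (ℚᵘ.*-cong (ℕ→ℚᵘ (suc n)) (ℚ.toℚᵘ-fromℚᵘ (mkℚᵘ (ℤ.+ 1) n)))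
    (*≡* (cong ℤ.+_ (lemma n)))))
  where
  lemma : ∀ n → (suc n) * 1 * 1 ≡ 1 * (1 * suc n)
  lemma = solve-∀

1/n-nonNeg : ∀ n .{{_ : NonZero n}} → ℚ.NonNegative 1/[ n ]
1/n-nonNeg n = ℚ.normalize-nonNeg 1 n

-- Counting and flows along walks

count : ∀ {n} → (Fin n → Bool) → ℕ
count S = sumℕ (λ i → if S i then 1 else 0)

-- Numbers the members of S in increasing order; with its injectivity, a subset can be treated as
-- `Fin (count S)` and cardinalities compared by injections.
rank : ∀ {n} (S : Fin n → Bool) i → S i ≡ true → Fin (count S)
rank S zero    h with S zero
rank S zero    h  | true = zero
rank S zero    () | false
rank S (suc i) h with S zero
... | true  = suc (rank (λ j → S (suc j)) i h)
... | false = rank (λ j → S (suc j)) i h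

rank-injective : ∀ {n} (S : Fin n → Bool) {i j} (hi : S i ≡ true) (hj : S j ≡ true) →
                 rank S i hi ≡ rank S j hj → i ≡ j
rank-injective S {zero}  {zero}  hi hj e = refl
rank-injective S {zero}  {suc j} hi hj e with S zero
rank-injective S {zero}  {suc j} hi hj () | true
rank-injective S {zero}  {suc j} () hj e  | false
rank-injective S {suc i} {zero}  hi hj e = sym (rank-injective S {zero} {suc i} hj hi (sym e))
rank-injective S {suc i} {suc j} hi hj e with S zero
... | true  = cong suc (rank-injective (λ j → S (suc j)) hi hj (Fin.suc-injective e))
... | false = cong suc (rank-injective (λ j → S (suc j)) hi hj e)

≤count*count : ∀ {p m n} (S : Fin m → Bool) (T : Fin n → Bool) (f : Fin p → Fin m) (g : Fin p → Fin n) →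
               (∀ x → S (f x) ≡ true) → (∀ x → T (g x) ≡ true) →
               (∀ {x y} → f x ≡ f y → g x ≡ g y → x ≡ y) → p ≤ count S * count T
≤count*count S T f g Sf Tg inj = Fin.injective⇒≤ {f = λ x → combine (rS x) (rT x)} λ {x} {y} e →
  let (e₁ , e₂) = Fin.combine-injective (rS x) (rT x) (rS y) (rT y) e in
  inj (rank-injective S (Sf x) (Sf y) e₁) (rank-injective T (Tg x) (Tg y) e₂)
  where
  rS = λ x → rank S (f x) (Sf x)
  rT = λ x → rank T (g x) (Tg x)

All-tabulate⁺ : ∀ {A : Set} {P : A → Set} {n} {f : Fin n → A} → (∀ i → P (f i)) → All P (tabulate f)
All-tabulate⁺ {n = zero}  h = []
All-tabulate⁺ {n = suc n} h = h zero ∷ All-tabulate⁺ (λ i → h (suc i))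

All-tabulate⁻ : ∀ {A : Set} {P : A → Set} {n} {f : Fin n → A} → All P (tabulate f) → ∀ i → P (f i)
All-tabulate⁻ (h ∷ hs) zero    = h
All-tabulate⁻ (h ∷ hs) (suc i) = All-tabulate⁻ hs i

All-++⁺ : ∀ {A : Set} {P : A → Set} {xs ys} → All P xs → All P ys → All P (xs ++ ys)
All-++⁺ []       qs = qs
All-++⁺ (p ∷ ps) qs = p ∷ All-++⁺ ps qs

All-++⁻ˡ : ∀ {A : Set} {P : A → Set} xs {ys} → All P (xs ++ ys) → All P xs
All-++⁻ˡ []       ps       = []
All-++⁻ˡ (x ∷ xs) (p ∷ ps) = p ∷ All-++⁻ˡ xs ps

load : ∀ {N ℓ M} → (Fin N → Fin ℓ → Fin M) → Fin M → ℕ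
load W e = sumℕ (λ v → sumℕ (λ i → δ e (W v i)))

-- Double counting: adding h over the edges with their loads is adding h along the walks. It turns
-- the flow through a node into a count of visits.
sum-*load : ∀ {N ℓ M} (W : Fin N → Fin ℓ → Fin M) (h : Fin M → ℕ) →
            sumℕ (λ e → h e * load W e) ≡ sumℕ (λ v → sumℕ (λ i → h (W v i)))
sum-*load W h = begin
  sumℕ (λ e → h e * load W e)
    ≡⟨ sum-cong (λ e → trans (sym (sum-*ˡ (h e) (λ v → sumℕ (λ i → δ e (W v i)))))
         (sum-cong (λ v → sym (sum-*ˡ (h e) (λ i → δ e (W v i)))))) ⟩
  sumℕ (λ e → sumℕ (λ v → sumℕ (λ i → h e * δ e (W v i))))
    ≡⟨ sum-swap (λ e v → sumℕ (λ i → h e * δ e (W v i))) ⟩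
  sumℕ (λ v → sumℕ (λ e → sumℕ (λ i → h e * δ e (W v i))))
    ≡⟨ sum-cong (λ v → trans (sum-swap (λ e i → h e * δ e (W v i))) (sum-cong (λ i → sum-*δ h (W v i)))) ⟩
  sumℕ (λ v → sumℕ (λ i → h (W v i))) ∎
  where open ≡-Reasoning

load≤ : ∀ {N ℓ M} (W : Fin N → Fin ℓ → Fin M) e → load W e ≤ N * ℓ
load≤ {N} {ℓ} W e = begin
  load W e                               ≤⟨ sum-mono {N} (λ v → sum-mono {ℓ} (λ i → δ≤1 e (W v i))) ⟩
  sumℕ {N} (λ _ → sumℕ {ℓ} (λ _ → 1))  ≡⟨ sum-const N _ ⟩
  N * sumℕ {ℓ} (λ _ → 1)                 ≡⟨ cong (N *_) (trans (sum-const ℓ 1) (*-identityʳ ℓ)) ⟩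
  N * ℓ                                  ∎
  where open ≤-Reasoning

module _ {n} (G : WDigraph n) where

  private
    netflow-sum : (end : Fin (m G) → Fin n) (F : Fin (m G) → ℕ) (r : ℚ) (u : Fin n) →
      sumℚ (λ e → if ⌊ end e Fin.≟ u ⌋ then ℕ→ℚ (F e) ℚ.* r else 0ℚ)
        ≡ ℕ→ℚ (sumℕ (λ e → δ (end e) u * F e)) ℚ.* r
    netflow-sum end F r u = trans (sumℚ-cong term) (sumℚ-scaled (λ e → δ (end e) u * F e) r)
      where
      term : ∀ e → (if ⌊ end e Fin.≟ u ⌋ then ℕ→ℚ (F e) ℚ.* r else 0ℚ) ≡ ℕ→ℚ (δ (end e) u * F e) ℚ.* r
      term e with end e Fin.≟ u
      ... | yes _ = cong (λ k → ℕ→ℚ k ℚ.* r) (sym (+-identityʳ (F e)))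
      ... | no _  = sym (ℚ.*-zeroˡ r)

  -- Each of the N walks carries flow 1/N.
  walks⇒flow : ∀ {N ℓ} .{{_ : NonZero N}} {s t} (W : Fin N → Fin ℓ → Fin (m G)) (X : Fin (m G) → ℕ) → s ≢ t →
    (∀ v u → sumℕ (λ i → δ (tgt G (W v i)) u) + δ s u ≡ sumℕ (λ i → δ (src G (W v i)) u) + δ t u) →
    (∀ e → load W e ≤ X e) → SupportsFlow G (λ e → ℕ→ℚ (X e) ℚ.* 1/[ N ]) s t
  walks⇒flow {N} {ℓ} {s} {t} W X s≢t walk cap = inj₂ (f , nonneg , below , conserve , value)
    where
    r = 1/[ N ]
    instance
      r≥0 : ℚ.NonNegative r
      r≥0 = 1/n-nonNeg N
    f : Fin (m G) → ℚ
    f e = ℕ→ℚ (load W e) ℚ.* r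
    nonneg : ∀ e → 0ℚ ℚ.≤ f e
    nonneg e = subst (ℚ._≤ f e) (ℚ.*-zeroˡ r) (ℚ.*-monoʳ-≤-nonNeg r (0≤ℕ→ℚ (load W e)))
    below : ∀ e → f e ℚ.≤ ℕ→ℚ (X e) ℚ.* r
    below e = ℚ.*-monoʳ-≤-nonNeg r (ℕ→ℚ-mono (cap e))
    inN outN : Fin n → ℕ
    inN  u = sumℕ (λ v → sumℕ (λ i → δ (tgt G (W v i)) u))
    outN u = sumℕ (λ v → sumℕ (λ i → δ (src G (W v i)) u))
    inflow≡ : ∀ u → inflow G f u ≡ ℕ→ℚ (inN u) ℚ.* r
    inflow≡ u = trans (netflow-sum (tgt G) (load W) r u)
      (cong (λ k → ℕ→ℚ k ℚ.* r) (sum-*load W (λ e → δ (tgt G e) u)))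
    outflow≡ : ∀ u → outflow G f u ≡ ℕ→ℚ (outN u) ℚ.* r
    outflow≡ u = trans (netflow-sum (src G) (load W) r u)
      (cong (λ k → ℕ→ℚ k ℚ.* r) (sum-*load W (λ e → δ (src G e) u)))
    -- Adding up the hypothesis on the single walks: the only imbalances are N units leaving s and N
    -- units arriving at t, which the factor 1/N makes into a flow of value 1.
    balance : ∀ u → inN u + N * δ s u ≡ outN u + N * δ t u
    balance u = begin
      inN u + N * δ s u                      ≡⟨ cong (inN u +_) (sum-const N (δ s u)) ⟨
      inN u + sumℕ {N} (λ _ → δ s u)         ≡⟨ sum-+ (λ v → sumℕ (λ i → δ (tgt G (W v i)) u)) (λ _ → δ s u) ⟨
      sumℕ (λ v → sumℕ (λ i → δ (tgt G (W v i)) u) + δ s u) ≡⟨ sum-cong (λ v → walk v u) ⟩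
      sumℕ (λ v → sumℕ (λ i → δ (src G (W v i)) u) + δ t u) ≡⟨ sum-+ (λ v → sumℕ (λ i → δ (src G (W v i)) u)) (λ _ → δ t u) ⟩
      outN u + sumℕ {N} (λ _ → δ t u)        ≡⟨ cong (outN u +_) (sum-const N (δ t u)) ⟩
      outN u + N * δ t u                     ∎
      where open ≡-Reasoning
    N*δ≢ : ∀ {u v : Fin n} → u ≢ v → N * δ u v ≡ 0
    N*δ≢ u≢v = trans (cong (N *_) (δ-≢ u≢v)) (*-zeroʳ N)
    conserve : ∀ u → u ≢ s → u ≢ t → inflow G f u ≡ outflow G f u
    conserve u u≢s u≢t = trans (inflow≡ u) (trans (cong (λ k → ℕ→ℚ k ℚ.* r) in≡out) (sym (outflow≡ u)))
      where
      in≡out : inN u ≡ outN u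
      in≡out = begin
        inN u              ≡⟨ +-identityʳ _ ⟨
        inN u + 0          ≡⟨ cong (inN u +_) (N*δ≢ (λ e → u≢s (sym e))) ⟨
        inN u + N * δ s u  ≡⟨ balance u ⟩
        outN u + N * δ t u ≡⟨ cong (outN u +_) (N*δ≢ (λ e → u≢t (sym e))) ⟩
        outN u + 0         ≡⟨ +-identityʳ _ ⟩
        outN u             ∎
        where open ≡-Reasoning
    out-s : outN s ≡ N + inN s
    out-s = begin
      outN s             ≡⟨ +-identityʳ _ ⟨
      outN s + 0         ≡⟨ cong (outN s +_) (N*δ≢ (λ e → s≢t (sym e))) ⟨
      outN s + N * δ t s ≡⟨ balance s ⟨
      inN s + N * δ s s  ≡⟨ cong (λ k → inN s + N * k) (δ-refl s) ⟩
      inN s + N * 1      ≡⟨ cong (inN s +_) (*-identityʳ N) ⟩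
      inN s + N          ≡⟨ +-comm (inN s) N ⟩
      N + inN s          ∎
      where open ≡-Reasoning
    value : outflow G f s ℚ.- inflow G f s ≡ 1ℚ
    value = begin
      outflow G f s ℚ.- inflow G f s         ≡⟨ cong₂ ℚ._-_ (outflow≡ s) (inflow≡ s) ⟩
      ℕ→ℚ (outN s) ℚ.* r ℚ.- I               ≡⟨ cong (λ k → ℕ→ℚ k ℚ.* r ℚ.- I) out-s ⟩
      ℕ→ℚ (N + inN s) ℚ.* r ℚ.- I            ≡⟨ cong (λ k → k ℚ.* r ℚ.- I) (ℕ→ℚ-+ N (inN s)) ⟩
      (ℕ→ℚ N ℚ.+ ℕ→ℚ (inN s)) ℚ.* r ℚ.- I    ≡⟨ cong (ℚ._- I) (ℚ.*-distribʳ-+ r (ℕ→ℚ N) (ℕ→ℚ (inN s))) ⟩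
      ℕ→ℚ N ℚ.* r ℚ.+ I ℚ.- I                ≡⟨ ℚ.+-assoc (ℕ→ℚ N ℚ.* r) I (ℚ.- I) ⟩
      ℕ→ℚ N ℚ.* r ℚ.+ (I ℚ.- I)              ≡⟨ cong (ℕ→ℚ N ℚ.* r ℚ.+_) (ℚ.+-inverseʳ I) ⟩
      ℕ→ℚ N ℚ.* r ℚ.+ 0ℚ                     ≡⟨ ℚ.+-identityʳ _ ⟩
      ℕ→ℚ N ℚ.* r                            ≡⟨ n*1/n≡1 N ⟩
      1ℚ                                     ∎
      where
      open ≡-Reasoning
      I = ℕ→ℚ (inN s) ℚ.* r

-- The Steiner forest instance of a family of induced matchings

↑ˡ≢↑ʳ : ∀ {m n} (i : Fin m) (j : Fin n) → i ↑ˡ n ≢ m ↑ʳ j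
↑ˡ≢↑ʳ {m} {n} i j e with trans (sym (Fin.splitAt-↑ˡ m i n)) (trans (cong (splitAt m) e) (Fin.splitAt-↑ʳ m n j))
... | ()

δ-↑ˡ : ∀ {m} n (i j : Fin m) → δ (i ↑ˡ n) (j ↑ˡ n) ≡ δ i j
δ-↑ˡ n i j with i Fin.≟ j
... | yes refl = δ-refl (i ↑ˡ n)
... | no i≢j   = δ-≢ (λ e → i≢j (Fin.↑ˡ-injective n i j e))

-- p matchings {a x u — b x u : u < σ} in a bipartite graph with K + K nodes,
-- each of them induced in the union of all.
record InducedMatchings (p σ K : ℕ) : Set where
  field
    a b     : Fin p → Fin σ → Fin K
    induced : ∀ {x z u u′ w} → a x u ≡ a z w → b x u′ ≡ b z w → u ≡ u′ × x ≡ z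

module Instance {p σ K : ℕ} (q : ℕ) .{{_ : NonZero σ}} (R : InducedMatchings p σ K) where

  open InducedMatchings R

  a-injective : ∀ x {u v} → a x u ≡ a x v → u ≡ v
  a-injective x e = proj₁ (induced e refl)

  b-injective : ∀ x {u v} → b x u ≡ b x v → u ≡ v
  b-injective x e = sym (proj₁ (induced refl e))

  -- Slot α of either side is split into an in-node and an out-node joined by its edge of weight 1;
  -- the pad nodes reach everything for free and only serve to raise the number of demands.
  data Node : Set where
    s t         : Fin p → Node
    ai ao bi bo : Fin K → Node
    pad         : Fin q → Node

  #nodes : ℕ
  #nodes = p + (p + (K + (K + (K + (K + q)))))

  node : Node → Fin #nodes
  node (s x)   = x ↑ˡ _
  node (t x)   = p ↑ʳ (x ↑ˡ _)
  node (ai α)  = p ↑ʳ (p ↑ʳ (α ↑ˡ _))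
  node (ao α)  = p ↑ʳ (p ↑ʳ (K ↑ʳ (α ↑ˡ _)))
  node (bi β)  = p ↑ʳ (p ↑ʳ (K ↑ʳ (K ↑ʳ (β ↑ˡ _))))
  node (bo β)  = p ↑ʳ (p ↑ʳ (K ↑ʳ (K ↑ʳ (K ↑ʳ (β ↑ˡ _)))))
  node (pad i) = p ↑ʳ (p ↑ʳ (K ↑ʳ (K ↑ʳ (K ↑ʳ (K ↑ʳ i)))))

  -- A left inverse of `node`: it gives injectivity, and it lets an invariant on `Fin #nodes` be
  -- defined by cases on `Node`.
  node⁻¹ : Fin #nodes → Node
  node⁻¹ v = [ s , (λ v → [ t , (λ v → [ ai , (λ v → [ ao , (λ v → [ bi , (λ v → [ bo , pad ]′
    (splitAt K v)) ]′ (splitAt K v)) ]′ (splitAt K v)) ]′ (splitAt K v)) ]′ (splitAt p v)) ]′ (splitAt p v)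

  node⁻¹-node : ∀ v → node⁻¹ (node v) ≡ v
  node⁻¹-node (s x)
    rewrite Fin.splitAt-↑ˡ p x (p + (K + (K + (K + (K + q))))) = refl
  node⁻¹-node (t x)
    rewrite Fin.splitAt-↑ʳ p (p + (K + (K + (K + (K + q))))) (x ↑ˡ (K + (K + (K + (K + q)))))
          | Fin.splitAt-↑ˡ p x (K + (K + (K + (K + q)))) = refl
  node⁻¹-node (ai α)
    rewrite Fin.splitAt-↑ʳ p (p + (K + (K + (K + (K + q))))) (p ↑ʳ (α ↑ˡ (K + (K + (K + q)))))
          | Fin.splitAt-↑ʳ p (K + (K + (K + (K + q)))) (α ↑ˡ (K + (K + (K + q))))
          | Fin.splitAt-↑ˡ K α (K + (K + (K + q))) = refl
  node⁻¹-node (ao α)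
    rewrite Fin.splitAt-↑ʳ p (p + (K + (K + (K + (K + q))))) (p ↑ʳ (K ↑ʳ (α ↑ˡ (K + (K + q)))))
          | Fin.splitAt-↑ʳ p (K + (K + (K + (K + q)))) (K ↑ʳ (α ↑ˡ (K + (K + q))))
          | Fin.splitAt-↑ʳ K (K + (K + (K + q))) (α ↑ˡ (K + (K + q)))
          | Fin.splitAt-↑ˡ K α (K + (K + q)) = refl
  node⁻¹-node (bi β)
    rewrite Fin.splitAt-↑ʳ p (p + (K + (K + (K + (K + q))))) (p ↑ʳ (K ↑ʳ (K ↑ʳ (β ↑ˡ (K + q)))))
          | Fin.splitAt-↑ʳ p (K + (K + (K + (K + q)))) (K ↑ʳ (K ↑ʳ (β ↑ˡ (K + q))))
          | Fin.splitAt-↑ʳ K (K + (K + (K + q))) (K ↑ʳ (β ↑ˡ (K + q)))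
          | Fin.splitAt-↑ʳ K (K + (K + q)) (β ↑ˡ (K + q))
          | Fin.splitAt-↑ˡ K β (K + q) = refl
  node⁻¹-node (bo β)
    rewrite Fin.splitAt-↑ʳ p (p + (K + (K + (K + (K + q))))) (p ↑ʳ (K ↑ʳ (K ↑ʳ (K ↑ʳ (β ↑ˡ q)))))
          | Fin.splitAt-↑ʳ p (K + (K + (K + (K + q)))) (K ↑ʳ (K ↑ʳ (K ↑ʳ (β ↑ˡ q))))
          | Fin.splitAt-↑ʳ K (K + (K + (K + q))) (K ↑ʳ (K ↑ʳ (β ↑ˡ q)))
          | Fin.splitAt-↑ʳ K (K + (K + q)) (K ↑ʳ (β ↑ˡ q))
          | Fin.splitAt-↑ʳ K (K + q) (β ↑ˡ q)
          | Fin.splitAt-↑ˡ K β q = refl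
  node⁻¹-node (pad i)
    rewrite Fin.splitAt-↑ʳ p (p + (K + (K + (K + (K + q))))) (p ↑ʳ (K ↑ʳ (K ↑ʳ (K ↑ʳ (K ↑ʳ i)))))
          | Fin.splitAt-↑ʳ p (K + (K + (K + (K + q)))) (K ↑ʳ (K ↑ʳ (K ↑ʳ (K ↑ʳ i))))
          | Fin.splitAt-↑ʳ K (K + (K + (K + q))) (K ↑ʳ (K ↑ʳ (K ↑ʳ i)))
          | Fin.splitAt-↑ʳ K (K + (K + q)) (K ↑ʳ (K ↑ʳ i))
          | Fin.splitAt-↑ʳ K (K + q) (K ↑ʳ i)
          | Fin.splitAt-↑ʳ K q i = refl

  node-injective : ∀ {v w} → node v ≡ node w → v ≡ w
  node-injective {v} {w} e = trans (sym (node⁻¹-node v)) (trans (cong node⁻¹ e) (node⁻¹-node w))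

  data Edge : Set where
    wa wb    : Fin K → Edge
    sa ab bt : Fin p → Fin σ → Edge
    free     : Fin q → Fin #nodes → Edge

  #free #edges : ℕ
  #free  = p * σ + (p * σ + (p * σ + q * #nodes))
  #edges = (K + K) + #free

  -- The weighted edges occupy the first K + K indices, so that a single `splitAt` decides both the
  -- weight and the capacity of an edge.
  weighted : Fin (K + K) → Edge
  weighted i = [ wa , wb ]′ (splitAt K i)

  unweighted : Fin #free → Edge
  unweighted e = [ (λ i → sa (proj₁ (remQuot σ i)) (proj₂ (remQuot {p} σ i)))
    , (λ e → [ (λ i → ab (proj₁ (remQuot σ i)) (proj₂ (remQuot {p} σ i)))
    , (λ e → [ (λ i → bt (proj₁ (remQuot σ i)) (proj₂ (remQuot {p} σ i)))
    , (λ i → free (proj₁ (remQuot #nodes i)) (proj₂ (remQuot {q} #nodes i))) ]′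
    (splitAt (p * σ) e)) ]′ (splitAt (p * σ) e)) ]′ (splitAt (p * σ) e)

  edge⁻¹ : Fin #edges → Edge
  edge⁻¹ e = [ weighted , unweighted ]′ (splitAt (K + K) e)

  edge : Edge → Fin #edges
  edge (wa α)     = (α ↑ˡ K) ↑ˡ #free
  edge (wb β)     = (K ↑ʳ β) ↑ˡ #free
  edge (sa x u)   = (K + K) ↑ʳ (combine x u ↑ˡ _)
  edge (ab x u)   = (K + K) ↑ʳ (p * σ ↑ʳ (combine x u ↑ˡ _))
  edge (bt x u)   = (K + K) ↑ʳ (p * σ ↑ʳ (p * σ ↑ʳ (combine x u ↑ˡ _)))
  edge (free i v) = (K + K) ↑ʳ (p * σ ↑ʳ (p * σ ↑ʳ (p * σ ↑ʳ combine i v)))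

  edge⁻¹-edge : ∀ e → edge⁻¹ (edge e) ≡ e
  edge⁻¹-edge (wa α)
    rewrite Fin.splitAt-↑ˡ (K + K) (α ↑ˡ K) #free | Fin.splitAt-↑ˡ K α K = refl
  edge⁻¹-edge (wb β)
    rewrite Fin.splitAt-↑ˡ (K + K) (K ↑ʳ β) #free | Fin.splitAt-↑ʳ K K β = refl
  edge⁻¹-edge (sa x u)
    rewrite Fin.splitAt-↑ʳ (K + K) #free (combine x u ↑ˡ (p * σ + (p * σ + q * #nodes)))
          | Fin.splitAt-↑ˡ (p * σ) (combine x u) (p * σ + (p * σ + q * #nodes))
          = cong (λ r → sa (proj₁ r) (proj₂ r)) (Fin.remQuot-combine x u)
  edge⁻¹-edge (ab x u)
    rewrite Fin.splitAt-↑ʳ (K + K) #free (p * σ ↑ʳ (combine x u ↑ˡ (p * σ + q * #nodes)))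
          | Fin.splitAt-↑ʳ (p * σ) (p * σ + (p * σ + q * #nodes)) (combine x u ↑ˡ (p * σ + q * #nodes))
          | Fin.splitAt-↑ˡ (p * σ) (combine x u) (p * σ + q * #nodes)
          = cong (λ r → ab (proj₁ r) (proj₂ r)) (Fin.remQuot-combine x u)
  edge⁻¹-edge (bt x u)
    rewrite Fin.splitAt-↑ʳ (K + K) #free (p * σ ↑ʳ (p * σ ↑ʳ (combine x u ↑ˡ (q * #nodes))))
          | Fin.splitAt-↑ʳ (p * σ) (p * σ + (p * σ + q * #nodes)) (p * σ ↑ʳ (combine x u ↑ˡ (q * #nodes)))
          | Fin.splitAt-↑ʳ (p * σ) (p * σ + q * #nodes) (combine x u ↑ˡ (q * #nodes))
          | Fin.splitAt-↑ˡ (p * σ) (combine x u) (q * #nodes)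
          = cong (λ r → bt (proj₁ r) (proj₂ r)) (Fin.remQuot-combine x u)
  edge⁻¹-edge (free i v)
    rewrite Fin.splitAt-↑ʳ (K + K) #free (p * σ ↑ʳ (p * σ ↑ʳ (p * σ ↑ʳ combine i v)))
          | Fin.splitAt-↑ʳ (p * σ) (p * σ + (p * σ + q * #nodes)) (p * σ ↑ʳ (p * σ ↑ʳ combine i v))
          | Fin.splitAt-↑ʳ (p * σ) (p * σ + q * #nodes) (p * σ ↑ʳ combine i v)
          | Fin.splitAt-↑ʳ (p * σ) (q * #nodes) (combine i v)
          = cong (λ r → free (proj₁ r) (proj₂ r)) (Fin.remQuot-combine i v)

  -- A subgraph is given on indices, while the counts speak of `H (edge (wa α))`; an index decoding
  -- to `wa α` therefore has to be this one. The same is needed for `wb`.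
  edge⁻¹≡wa : ∀ e {α} → edge⁻¹ e ≡ wa α → e ≡ edge (wa α)
  edge⁻¹≡wa e eq with splitAt (K + K) e in eq₁
  edge⁻¹≡wa e eq | inj₁ i with splitAt K i in eq₂
  edge⁻¹≡wa e refl | inj₁ i | inj₁ α =
    sym (trans (cong (_↑ˡ #free) (Fin.splitAt⁻¹-↑ˡ eq₂)) (Fin.splitAt⁻¹-↑ˡ eq₁))
  edge⁻¹≡wa e () | inj₁ i | inj₂ β
  edge⁻¹≡wa e eq | inj₂ j with splitAt (p * σ) j
  edge⁻¹≡wa e () | inj₂ j | inj₁ _
  ... | inj₂ j′ with splitAt (p * σ) j′
  edge⁻¹≡wa e () | inj₂ j | inj₂ j′ | inj₁ _
  ... | inj₂ j″ with splitAt (p * σ) j″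
  edge⁻¹≡wa e () | inj₂ j | inj₂ j′ | inj₂ j″ | inj₁ _
  edge⁻¹≡wa e () | inj₂ j | inj₂ j′ | inj₂ j″ | inj₂ _

  edge⁻¹≡wb : ∀ e {β} → edge⁻¹ e ≡ wb β → e ≡ edge (wb β)
  edge⁻¹≡wb e eq with splitAt (K + K) e in eq₁
  edge⁻¹≡wb e eq | inj₁ i with splitAt K i in eq₂
  edge⁻¹≡wb e () | inj₁ i | inj₁ α
  edge⁻¹≡wb e refl | inj₁ i | inj₂ β =
    sym (trans (cong (_↑ˡ #free) (Fin.splitAt⁻¹-↑ʳ eq₂)) (Fin.splitAt⁻¹-↑ˡ eq₁))
  edge⁻¹≡wb e eq | inj₂ j with splitAt (p * σ) j
  edge⁻¹≡wb e () | inj₂ j | inj₁ _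
  ... | inj₂ j′ with splitAt (p * σ) j′
  edge⁻¹≡wb e () | inj₂ j | inj₂ j′ | inj₁ _
  ... | inj₂ j″ with splitAt (p * σ) j″
  edge⁻¹≡wb e () | inj₂ j | inj₂ j′ | inj₂ j″ | inj₁ _
  edge⁻¹≡wb e () | inj₂ j | inj₂ j′ | inj₂ j″ | inj₂ _

  source target : Edge → Fin #nodes
  source (wa α)     = node (ai α)
  source (wb β)     = node (bi β)
  source (sa x u)   = node (s x)
  source (ab x u)   = node (ao (a x u))
  source (bt x u)   = node (bo (b x u))
  source (free i v) = node (pad i)
  target (wa α)     = node (ao α)
  target (wb β)     = node (bo β)
  target (sa x u)   = node (ai (a x u))
  target (ab x u)   = node (bi (b x u))
  target (bt x u)   = node (t x)
  target (free i v) = v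

  w : Fin #edges → ℕ
  w e = [ (λ _ → 1) , (λ _ → 0) ]′ (splitAt (K + K) e)

  G : WDigraph #nodes
  G = record
    { m = #edges
    ; src = λ e → source (edge⁻¹ e)
    ; tgt = λ e → target (edge⁻¹ e)
    ; weight = λ e → ℕ→ℚ (w e)
    ; weight-nonneg = λ e → 0≤ℕ→ℚ (w e)
    }

  src-edge : ∀ e → src G (edge e) ≡ source e
  src-edge e = cong source (edge⁻¹-edge e)

  tgt-edge : ∀ e → tgt G (edge e) ≡ target e
  tgt-edge e = cong target (edge⁻¹-edge e)

  weightℕ : Subgraph G → ℕ
  weightℕ H = sumℕ (λ e → if H e then w e else 0)

  subWeight≡ : ∀ H → subWeight G H ≡ ℕ→ℚ (weightℕ H)
  subWeight≡ H = trans (sumℚ-cong term) (sumℚ-ℕ→ℚ (λ e → if H e then w e else 0))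
    where
    term : ∀ e → (if H e then weight G e else 0ℚ) ≡ ℕ→ℚ (if H e then w e else 0)
    term e with H e
    ... | true  = refl
    ... | false = refl

  count≤weightℕ : ∀ H → count (λ α → H (edge (wa α))) + count (λ β → H (edge (wb β))) ≤ weightℕ H
  count≤weightℕ H = begin
    count (λ α → H (edge (wa α))) + count (λ β → H (edge (wb β)))
      ≡⟨ sum-split K (λ i → if H (i ↑ˡ #free) then 1 else 0) ⟨
    sumℕ {K + K} (λ i → if H (i ↑ˡ #free) then 1 else 0)
      ≡⟨ sum-cong (λ i → cong (λ k → if H (i ↑ˡ #free) then [ (λ _ → 1) , (λ _ → 0) ]′ k else 0)
           (Fin.splitAt-↑ˡ (K + K) i #free)) ⟨
    sumℕ {K + K} (λ i → if H (i ↑ˡ #free) then w (i ↑ˡ #free) else 0)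
      ≤⟨ m≤m+n _ _ ⟩
    sumℕ {K + K} (λ i → if H (i ↑ˡ #free) then w (i ↑ˡ #free) else 0) +
    sumℕ (λ j → if H ((K + K) ↑ʳ j) then w ((K + K) ↑ʳ j) else 0)
      ≡⟨ sum-split (K + K) (λ e → if H e then w e else 0) ⟨
    weightℕ H ∎
    where open ≤-Reasoning

  -- σ times the LP solution
  X : Fin #edges → ℕ
  X e = [ (λ _ → 1) , (λ _ → σ * 5) ]′ (splitAt (K + K) e)

  x̂ : Fin #edges → ℚ
  x̂ e = ℕ→ℚ (X e) ℚ.* 1/[ σ ]

  LPCost≡ : LPCost G x̂ ≡ ℕ→ℚ (K + K) ℚ.* 1/[ σ ]
  LPCost≡ = begin
    sumℚ (λ e → ℕ→ℚ (w e) ℚ.* (ℕ→ℚ (X e) ℚ.* 1/[ σ ]))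
      ≡⟨ sumℚ-cong (λ e → trans (sym (ℚ.*-assoc (ℕ→ℚ (w e)) (ℕ→ℚ (X e)) 1/[ σ ]))
           (cong (ℚ._* 1/[ σ ]) (sym (ℕ→ℚ-* (w e) (X e))))) ⟩
    sumℚ (λ e → ℕ→ℚ (w e * X e) ℚ.* 1/[ σ ])
      ≡⟨ sumℚ-scaled (λ e → w e * X e) 1/[ σ ] ⟩
    ℕ→ℚ (sumℕ (λ e → w e * X e)) ℚ.* 1/[ σ ]
      ≡⟨ cong (λ k → ℕ→ℚ k ℚ.* 1/[ σ ]) total ⟩
    ℕ→ℚ (K + K) ℚ.* 1/[ σ ] ∎
    where
    open ≡-Reasoning
    total : sumℕ (λ e → w e * X e) ≡ K + K
    total = begin
      sumℕ (λ e → w e * X e)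
        ≡⟨ sum-split (K + K) (λ e → w e * X e) ⟩
      sumℕ {K + K} (λ i → w (i ↑ˡ #free) * X (i ↑ˡ #free)) + sumℕ (λ j → w ((K + K) ↑ʳ j) * X ((K + K) ↑ʳ j))
        ≡⟨ cong₂ _+_ (sum-cong onWeighted) (sum-zero onFree) ⟩
      sumℕ {K + K} (λ _ → 1) + 0
        ≡⟨ trans (+-identityʳ _) (trans (sum-const (K + K) 1) (*-identityʳ (K + K))) ⟩
      K + K ∎
      where
      onWeighted : ∀ i → w (i ↑ˡ #free) * X (i ↑ˡ #free) ≡ 1
      onWeighted i rewrite Fin.splitAt-↑ˡ (K + K) i #free = refl
      onFree : ∀ j → w ((K + K) ↑ʳ j) * X ((K + K) ↑ʳ j) ≡ 0
      onFree j rewrite Fin.splitAt-↑ʳ (K + K) #free j = refl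

  route : Fin p → Fin σ → Fin 5 → Edge
  route x u zero                         = sa x u
  route x u (suc zero)                   = wa (a x u)
  route x u (suc (suc zero))             = ab x u
  route x u (suc (suc (suc zero)))       = wb (b x u)
  route x u (suc (suc (suc (suc zero)))) = bt x u

  -- Along a route each target is the next source, so that the two sums differ only at the ends.
  telescope : ∀ s a a′ b b′ t →
    (a + (a′ + (b + (b′ + (t + 0))))) + s ≡ (s + (a + (a′ + (b + (b′ + 0))))) + t
  telescope = solve-∀

  route-walk : ∀ x v u → sumℕ (λ i → δ (tgt G (edge (route x v i))) u) + δ (node (s x)) u
                       ≡ sumℕ (λ i → δ (src G (edge (route x v i))) u) + δ (node (t x)) u
  route-walk x v u = begin
    sumℕ (λ i → δ (tgt G (edge (route x v i))) u) + δ (node (s x)) u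
      ≡⟨ cong (_+ δ (node (s x)) u) (sum-cong (λ i → cong (λ y → δ y u) (tgt-edge (route x v i)))) ⟩
    sumℕ (λ i → δ (target (route x v i)) u) + δ (node (s x)) u
      ≡⟨ telescope (δ (node (s x)) u) (δ (node (ai (a x v))) u) (δ (node (ao (a x v))) u)
           (δ (node (bi (b x v))) u) (δ (node (bo (b x v))) u) (δ (node (t x)) u) ⟩
    sumℕ (λ i → δ (source (route x v i)) u) + δ (node (t x)) u
      ≡⟨ cong (_+ δ (node (t x)) u) (sum-cong (λ i → cong (λ y → δ y u) (src-edge (route x v i)))) ⟨
    sumℕ (λ i → δ (src G (edge (route x v i))) u) + δ (node (t x)) u ∎
    where open ≡-Reasoning

  -- The σ routes of one demand follow the edges of one matching, so no two of them meet in a slot.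
  -- Hence capacity 1/σ on the weighted edges is enough: this is the saving of the LP.
  route-load : ∀ x e → load (λ v i → edge (route x v i)) e ≤ X e
  route-load x e with splitAt (K + K) e in eq
  -- σ routes of 5 edges cannot load an edge more than `σ * 5` times; such a capacity costs nothing
  -- where the weight is 0.
  ... | inj₂ _ = load≤ (λ v i → edge (route x v i)) e
  ... | inj₁ i with refl ← Fin.splitAt⁻¹-↑ˡ eq = begin
    load (λ v j → edge (route x v j)) (i ↑ˡ #free)
      ≡⟨ sum-cong (λ v → trans
           (cong₂ _+_ (off (combine x v ↑ˡ _)) (cong₂ _+_ (δ-↑ˡ #free i (a x v ↑ˡ K))
             (cong₂ _+_ (off _) (cong₂ _+_ (δ-↑ˡ #free i (K ↑ʳ b x v)) (cong (_+ 0) (off _))))))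
           (cong (δ i (a x v ↑ˡ K) +_) (+-identityʳ (δ i (K ↑ʳ b x v))))) ⟩
    sumℕ (λ v → δ i (a x v ↑ˡ K) + δ i (K ↑ʳ b x v))
      ≡⟨ sum-+ (λ v → δ i (a x v ↑ˡ K)) (λ v → δ i (K ↑ʳ b x v)) ⟩
    sumℕ (λ v → δ i (a x v ↑ˡ K)) + sumℕ (λ v → δ i (K ↑ʳ b x v))
      ≤⟨ disjoint (splitAt K i) refl ⟩
    1 ∎
    where
    open ≤-Reasoning
    off : (j : Fin #free) → δ (i ↑ˡ #free) ((K + K) ↑ʳ j) ≡ 0
    off j = δ-≢ (↑ˡ≢↑ʳ i j)
    disjoint : ∀ c → splitAt K i ≡ c →
      sumℕ (λ v → δ i (a x v ↑ˡ K)) + sumℕ (λ v → δ i (K ↑ʳ b x v)) ≤ 1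
    disjoint (inj₁ α) eq′ with refl ← Fin.splitAt⁻¹-↑ˡ eq′ = begin
      sumℕ (λ v → δ i (a x v ↑ˡ K)) + sumℕ (λ v → δ i (K ↑ʳ b x v))
        ≡⟨ cong (sumℕ (λ v → δ i (a x v ↑ˡ K)) +_) (sum-zero {σ} {λ v → δ i (K ↑ʳ b x v)} (λ v → δ-≢ (↑ˡ≢↑ʳ α (b x v)))) ⟩
      sumℕ (λ v → δ i (a x v ↑ˡ K)) + 0
        ≡⟨ +-identityʳ _ ⟩
      sumℕ (λ v → δ i (a x v ↑ˡ K))
        ≤⟨ sum-δ-injective (λ v → a x v ↑ˡ K) (λ e → a-injective x (Fin.↑ˡ-injective K _ _ e)) i ⟩
      1 ∎
    disjoint (inj₂ β) eq′ with refl ← Fin.splitAt⁻¹-↑ʳ eq′ = begin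
      sumℕ (λ v → δ i (a x v ↑ˡ K)) + sumℕ (λ v → δ i (K ↑ʳ b x v))
        ≡⟨ cong (_+ sumℕ (λ v → δ i (K ↑ʳ b x v))) (sum-zero {σ} {λ v → δ i (a x v ↑ˡ K)} (λ v → δ-≢ (λ e → ↑ˡ≢↑ʳ (a x v) β (sym e)))) ⟩
      sumℕ (λ v → δ i (K ↑ʳ b x v))
        ≤⟨ sum-δ-injective (λ v → K ↑ʳ b x v) (λ e → b-injective x (Fin.↑ʳ-injective K _ _ e)) i ⟩
      1 ∎

  route-flow : ∀ x → SupportsFlow G x̂ (node (s x)) (node (t x))
  route-flow x = walks⇒flow G (λ v i → edge (route x v i)) X s≢t (route-walk x) (route-load x)
    where
    s≢t : node (s x) ≢ node (t x)
    s≢t e with node-injective {s x} {t x} e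
    ... | ()

  -- A pad demand takes its single edge σ times, which gives it the same denominator σ as the
  -- routes.
  free-load : ∀ i v e → load {σ} {1} (λ _ _ → edge (free i v)) e ≤ X e
  free-load i v e with splitAt (K + K) e in eq
  ... | inj₂ _ = ≤-trans (load≤ {σ} {1} (λ _ _ → edge (free i v)) e) (*-monoʳ-≤ σ (s≤s z≤n))
  ... | inj₁ j with refl ← Fin.splitAt⁻¹-↑ˡ eq =
    ≤-trans (≤-reflexive (sum-zero {σ} (λ _ → cong (_+ 0) (δ-≢ (↑ˡ≢↑ʳ j _))))) z≤n

  free-flow : ∀ i v → SupportsFlow G x̂ (node (pad i)) v
  free-flow i v with node (pad i) Fin.≟ v
  -- The padding ranges over all targets, the pad node itself included.
  ... | yes e = inj₁ e
  ... | no ne = walks⇒flow G {σ} {1} (λ _ _ → edge (free i v)) X ne walk (free-load i v)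
    where
    walk : ∀ (_ : Fin σ) u → sumℕ {1} (λ _ → δ (tgt G (edge (free i v))) u) + δ (node (pad i)) u
                           ≡ sumℕ {1} (λ _ → δ (src G (edge (free i v))) u) + δ v u
    walk _ u rewrite tgt-edge (free i v) | src-edge (free i v) = swap (δ v u) (δ (node (pad i)) u)
      where
      swap : ∀ c d → (c + 0) + d ≡ (d + 0) + c
      swap = solve-∀

  -- Every solution buys both ends of a matching edge for each demand

  module _ (H : Subgraph G) (y : Fin p) where

    -- The stages of a path to `t y`, read backwards. The matching z of the crossing edge is left
    -- open in `InvAo`, since the path may use edges that belong to other demands.
    InvBo InvBi InvAo InvAi : Fin K → Set
    InvBo β = Σ (Fin σ) λ u → β ≡ b y u
    InvBi β = H (edge (wb β)) ≡ true × InvBo β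
    InvAo α = Σ (Fin p) λ z → Σ (Fin σ) λ u → α ≡ a z u × InvBi (b z u)
    InvAi α = H (edge (wa α)) ≡ true × InvAo α

    -- A necessary condition for reaching t y, preserved backwards along the edges of H.
    Inv : Node → Set
    Inv (s x)   = Σ (Fin σ) λ u → InvAi (a x u)
    Inv (t x)   = x ≡ y
    Inv (ai α)  = InvAi α
    Inv (ao α)  = InvAo α
    Inv (bi β)  = InvBi β
    Inv (bo β)  = InvBo β
    Inv (pad i) = ⊤

    Inv-step : ∀ e → H e ≡ true → Inv (node⁻¹ (tgt G e)) → Inv (node⁻¹ (src G e))
    Inv-step e He inv with edge⁻¹ e in eq
    ... | wa α rewrite node⁻¹-node (ai α) | node⁻¹-node (ao α) =
      subst (λ e → H e ≡ true) (edge⁻¹≡wa e eq) He , inv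
    ... | wb β rewrite node⁻¹-node (bi β) | node⁻¹-node (bo β) =
      subst (λ e → H e ≡ true) (edge⁻¹≡wb e eq) He , inv
    ... | sa x u rewrite node⁻¹-node (s x) | node⁻¹-node (ai (a x u)) = u , inv
    ... | ab x u rewrite node⁻¹-node (ao (a x u)) | node⁻¹-node (bi (b x u)) = x , u , refl , inv
    ... | bt x u rewrite node⁻¹-node (bo (b x u)) | node⁻¹-node (t x) = u , cong (λ x → b x u) inv
    -- Edges into a pad node start at pad nodes, so asking nothing there does not weaken the
    -- invariant elsewhere.
    ... | free i v rewrite node⁻¹-node (pad i) = tt

    Inv-reach : ∀ {v v′} → v′ ≡ node (t y) → Reach G H v v′ → Inv (node⁻¹ v)
    Inv-reach refl here rewrite node⁻¹-node (t y) = refl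
    Inv-reach e (step d Hd r) = Inv-step d Hd (Inv-reach e r)

    -- The path crosses along an edge of some matching z that joins a left end of matching y to a
    -- right end of it. Being induced, matching y admits no foreign edge between its ends, so the
    -- crossing edge is its own and both slots are bought.
    reach⇒matching-edge : Reach G H (node (s y)) (node (t y)) →
      Σ (Fin σ) λ u → H (edge (wa (a y u))) ≡ true × H (edge (wb (b y u))) ≡ true
    reach⇒matching-edge r with subst Inv (node⁻¹-node (s y)) (Inv-reach refl r)
    ... | u , Ha , z , v , ayu≡azv , Hb , u′ , bzv≡byu′ with induced ayu≡azv (sym bzv≡byu′)
    ...   | refl , _ = u , Ha , subst (λ β → H (edge (wb β)) ≡ true) bzv≡byu′ Hb

  module _ (r : ℕ) (r≤ : r ≤ q * #nodes) where

    demand : Fin p → Fin #nodes × Fin #nodes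
    demand x = node (s x) , node (t x)

    padding : Fin r → Fin #nodes × Fin #nodes
    padding i = let j = remQuot #nodes (inject≤ i r≤) in node (pad (proj₁ j)) , proj₂ j

    demands : Demands #nodes
    demands = tabulate demand ++ tabulate padding

    demand-injective : ∀ {x y} → demand x ≡ demand y → x ≡ y
    demand-injective e with node-injective {s _} {s _} (,-injectiveˡ e)
    ... | refl = refl

    padding-injective : ∀ {i j} → padding i ≡ padding j → i ≡ j
    padding-injective {i} {j} e = Fin.inject≤-injective r≤ r≤ i j (begin
      inject≤ i r≤                                              ≡⟨ Fin.combine-remQuot {q} #nodes _ ⟨
      combine (proj₁ (rq i)) (proj₂ (rq i))                     ≡⟨ cong₂ combine (pad-inj (node-injective {pad _} {pad _} (,-injectiveˡ e))) (,-injectiveʳ e) ⟩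
      combine (proj₁ (rq j)) (proj₂ (rq j))                     ≡⟨ Fin.combine-remQuot {q} #nodes _ ⟩
      inject≤ j r≤                                              ∎)
      where
      open ≡-Reasoning
      rq : Fin r → Fin q × Fin #nodes
      rq i = remQuot #nodes (inject≤ i r≤)
      pad-inj : ∀ {i j} → pad i ≡ pad j → i ≡ j
      pad-inj refl = refl

    demands-unique : Unique demands
    demands-unique = Unique.++⁺ (Unique.tabulate⁺ demand-injective) (Unique.tabulate⁺ padding-injective) disjoint
      where
      disjoint : ∀ {v} → v ∈ tabulate demand × v ∈ tabulate padding → ⊥
      disjoint (∈₁ , ∈₂) with ∈-tabulate⁻ ∈₁ | ∈-tabulate⁻ ∈₂
      ... | x , refl | i , e with node-injective {s _} {pad _} (,-injectiveˡ e)
      ...   | ()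

    demands-length : length demands ≡ p + r
    demands-length = trans (length-++ (tabulate demand)) (cong₂ _+_ (length-tabulate demand) (length-tabulate padding))

    x̂-feasible : LPFeasible G demands x̂
    x̂-feasible = nonneg , All-++⁺ (All-tabulate⁺ route-flow)
      (All-tabulate⁺ (λ i → let j = remQuot #nodes (inject≤ i r≤) in free-flow (proj₁ j) (proj₂ j)))
      where
      nonneg : ∀ e → 0ℚ ℚ.≤ x̂ e
      nonneg e = subst (ℚ._≤ x̂ e) (ℚ.*-zeroˡ 1/[ σ ])
        (ℚ.*-monoʳ-≤-nonNeg 1/[ σ ] {{1/n-nonNeg σ}} (0≤ℕ→ℚ (X e)))

    edge-reach : ∀ e {v} → Reach G (λ _ → true) (target e) v → Reach G (λ _ → true) (source e) v
    edge-reach e {v} ρ = subst (λ y → Reach G (λ _ → true) y v) (src-edge e)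
      (step (edge e) refl (subst (λ y → Reach G (λ _ → true) y v) (sym (tgt-edge e)) ρ))

    G-feasible : Feasible G demands (λ _ → true)
    G-feasible = All-++⁺ (All-tabulate⁺ (λ x → along x (first σ)))
      (All-tabulate⁺ (λ i → let j = remQuot #nodes (inject≤ i r≤) in edge-reach (free (proj₁ j) (proj₂ j)) here))
      where
      first : ∀ σ .{{_ : NonZero σ}} → Fin σ
      first (suc _) = zero
      along : ∀ x → Fin σ → Reach G (λ _ → true) (node (s x)) (node (t x))
      along x u = edge-reach (sa x u) (edge-reach (wa (a x u)) (edge-reach (ab x u)
        (edge-reach (wb (b x u)) (edge-reach (bt x u) here))))

    4p≤weight² : ∀ H → Feasible G demands H → 4 * p ≤ weightℕ H * weightℕ H
    4p≤weight² H feas = begin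
      4 * p               ≤⟨ *-monoʳ-≤ 4 (≤count*count HA HB (λ x → a x (pick x)) (λ x → b x (pick x))
                               (λ x → proj₁ (proj₂ (matched x))) (λ x → proj₂ (proj₂ (matched x)))
                               (λ ea eb → proj₂ (induced ea eb))) ⟩
      4 * (count HA * count HB)                          ≤⟨ 4ab≤[a+b]² (count HA) (count HB) ⟩
      (count HA + count HB) * (count HA + count HB)      ≤⟨ *-mono-≤ (count≤weightℕ H) (count≤weightℕ H) ⟩
      weightℕ H * weightℕ H                              ∎
      where
      open ≤-Reasoning
      HA HB : Fin K → Bool
      HA α = H (edge (wa α))
      HB β = H (edge (wb β))
      matched : ∀ x → Σ (Fin σ) λ u → HA (a x u) ≡ true × HB (b x u) ≡ true
      matched x = reach⇒matching-edge H x (All-tabulate⁻ (All-++⁻ˡ (tabulate demand) feas) x)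
      pick : Fin p → Fin σ
      pick x = proj₁ (matched x)

    -- An optimal subgraph exists classically, which suffices since the conclusion is decidable.
    gap : ∀ k → GapBound #nodes (p + r) k → p * (σ * σ) ≤ (k * k) * (K * K)
    gap k bound = decidable-stable (_ ≤? _) λ fails →
      <-rec (λ N → ∀ H → Feasible G demands H → weightℕ H ≡ N → ⊥)
        (λ { _ rec H feas refl → fails (conclude H feas
          (λ H′ feas′ → ≮⇒≥ (λ lt → rec lt H′ feas′ refl))) })
        _ (λ _ → true) G-feasible refl
      where
      conclude : ∀ H → Feasible G demands H → (∀ H′ → Feasible G demands H′ → weightℕ H ≤ weightℕ H′) →
                 p * (σ * σ) ≤ (k * k) * (K * K)
      -- The integral optimum W has W² ≥ 4p, and the LP cost 2K/σ gives Wσ ≤ 2kK; both squares carry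
      -- the same factor 4.
      conclude H feas opt = *-cancelˡ-≤ 4 (begin
        4 * (p * (σ * σ))                    ≡⟨ *-assoc 4 p (σ * σ) ⟨
        4 * p * (σ * σ)                      ≤⟨ *-monoˡ-≤ (σ * σ) (4p≤weight² H feas) ⟩
        W * W * (σ * σ)                      ≡⟨ interchange W σ ⟩
        (W * σ) * (W * σ)                    ≤⟨ *-mono-≤ Wσ≤ Wσ≤ ⟩
        (k * (K + K)) * (k * (K + K))        ≡⟨ regroup k K ⟩
        4 * ((k * k) * (K * K))              ∎)
        where
        open ≤-Reasoning
        W = weightℕ H
        interchange : ∀ W σ → W * W * (σ * σ) ≡ (W * σ) * (W * σ)
        interchange = solve-∀
        regroup : ∀ k K → (k * (K + K)) * (k * (K + K)) ≡ 4 * ((k * k) * (K * K))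
        regroup = solve-∀
        isDSF : IsDSF G demands (ℕ→ℚ W)
        isDSF = (H , feas , subWeight≡ H) ,
          λ H′ feas′ → subst (ℕ→ℚ W ℚ.≤_) (sym (subWeight≡ H′)) (ℕ→ℚ-mono (opt H′ feas′))
        W≤ : ℕ→ℚ W ℚ.≤ ℕ→ℚ k ℚ.* (ℕ→ℚ (K + K) ℚ.* 1/[ σ ])
        W≤ = subst (λ c → ℕ→ℚ W ℚ.≤ ℕ→ℚ k ℚ.* c) LPCost≡
          (bound G demands demands-unique demands-length x̂ x̂-feasible (ℕ→ℚ W) isDSF)
        cancel-σ : ℕ→ℚ k ℚ.* (ℕ→ℚ (K + K) ℚ.* 1/[ σ ]) ℚ.* ℕ→ℚ σ ≡ ℕ→ℚ (k * (K + K))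
        cancel-σ = E.begin
          ℕ→ℚ k ℚ.* (ℕ→ℚ (K + K) ℚ.* 1/[ σ ]) ℚ.* ℕ→ℚ σ   E.≡⟨ cong (ℚ._* ℕ→ℚ σ) (ℚ.*-assoc (ℕ→ℚ k) (ℕ→ℚ (K + K)) 1/[ σ ]) ⟨
          ℕ→ℚ k ℚ.* ℕ→ℚ (K + K) ℚ.* 1/[ σ ] ℚ.* ℕ→ℚ σ     E.≡⟨ ℚ.*-assoc (ℕ→ℚ k ℚ.* ℕ→ℚ (K + K)) 1/[ σ ] (ℕ→ℚ σ) ⟩
          ℕ→ℚ k ℚ.* ℕ→ℚ (K + K) ℚ.* (1/[ σ ] ℚ.* ℕ→ℚ σ)   E.≡⟨ cong (ℕ→ℚ k ℚ.* ℕ→ℚ (K + K) ℚ.*_) (trans (ℚ.*-comm 1/[ σ ] (ℕ→ℚ σ)) (n*1/n≡1 σ)) ⟩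
          ℕ→ℚ k ℚ.* ℕ→ℚ (K + K) ℚ.* 1ℚ                    E.≡⟨ ℚ.*-identityʳ _ ⟩
          ℕ→ℚ k ℚ.* ℕ→ℚ (K + K)                           E.≡⟨ ℕ→ℚ-* k (K + K) ⟨
          ℕ→ℚ (k * (K + K))                               E.∎
          where module E = ≡-Reasoning
        Wσ≤ : W * σ ≤ k * (K + K)
        Wσ≤ = ℕ→ℚ-cancel-≤ (subst₂ ℚ._≤_ (sym (ℕ→ℚ-* W σ)) cancel-σ
          (ℚ.*-monoʳ-≤-nonNeg (ℕ→ℚ σ) {{ℚ.normalize-nonNeg σ 1}} W≤))

-- Path systems without 2-bridges

lookup-injective : ∀ {A : Set} {xs : List A} → Unique xs → ∀ {i j} → lookup xs i ≡ lookup xs j → i ≡ j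
lookup-injective (x∉ ∷ u) {zero}  {zero}  e = refl
lookup-injective (x∉ ∷ u) {zero}  {suc j} e = ⊥-elim (List.lookup x∉ (∈-lookup j) e)
lookup-injective (x∉ ∷ u) {suc i} {zero}  e = ⊥-elim (List.lookup x∉ (∈-lookup i) (sym e))
lookup-injective (x∉ ∷ u) {suc i} {suc j} e = cong suc (lookup-injective u e)

unique-pairs-length : ∀ {m n} {xs : List (Fin m × Fin n)} → Unique xs → length xs ≤ m * n
unique-pairs-length {xs = xs} u = Fin.injective⇒≤
  {f = λ i → combine (proj₁ (lookup xs i)) (proj₂ (lookup xs i))}
  λ e → lookup-injective u (let (e₁ , e₂) = Fin.combine-injective _ _ _ _ e in cong₂ _,_ e₁ e₂)

module _ {A : Set} where

  orderedPairs : List A → List (A × A)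
  orderedPairs []       = []
  orderedPairs (x ∷ xs) = map (x ,_) xs ++ orderedPairs xs

  -- The count ℓ(ℓ - 1)/2, free of subtraction and division.
  orderedPairs-length : ∀ xs → 2 * length (orderedPairs xs) + length xs ≡ length xs * length xs
  orderedPairs-length []       = refl
  orderedPairs-length (x ∷ xs) = begin
    2 * length (orderedPairs (x ∷ xs)) + suc ℓ
      ≡⟨ cong (λ k → 2 * k + suc ℓ) (trans (length-++ (map (x ,_) xs)) (cong (_+ T) (length-map (x ,_) xs))) ⟩
    2 * (ℓ + T) + suc ℓ      ≡⟨ regroup ℓ T ⟩
    suc (2 * ℓ) + (2 * T + ℓ) ≡⟨ cong (suc (2 * ℓ) +_) (orderedPairs-length xs) ⟩
    suc (2 * ℓ) + ℓ * ℓ      ≡⟨ square ℓ ⟩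
    suc ℓ * suc ℓ            ∎
    where
    open ≡-Reasoning
    ℓ = length xs
    T = length (orderedPairs xs)
    regroup : ∀ ℓ T → 2 * (ℓ + T) + suc ℓ ≡ suc (2 * ℓ) + (2 * T + ℓ)
    regroup = solve-∀
    square : ∀ ℓ → suc (2 * ℓ) + ℓ * ℓ ≡ suc ℓ * suc ℓ
    square = solve-∀

  orderedPairs-∈ : ∀ {u w} xs → (u , w) ∈ orderedPairs xs → u ∈ xs × w ∈ xs
  orderedPairs-∈ (x ∷ xs) uw∈ with ∈-++⁻ (map (x ,_) xs) uw∈
  ... | inj₁ ∈₁ with ∈-map⁻ (x ,_) ∈₁
  ...   | w , w∈ , refl = here refl , there w∈
  orderedPairs-∈ (x ∷ xs) uw∈ | inj₂ ∈₂ with orderedPairs-∈ xs ∈₂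
  ...   | u∈ , w∈ = there u∈ , there w∈

  orderedPairs-precedes : ∀ {u w} xs → (u , w) ∈ orderedPairs xs → Precedes u w xs
  orderedPairs-precedes (x ∷ xs) uw∈ with ∈-++⁻ (map (x ,_) xs) uw∈
  ... | inj₁ ∈₁ with ∈-map⁻ (x ,_) ∈₁
  ...   | w , w∈ , refl with ∈-∃++ w∈
  ...     | ys , zs , e = [] , ys , zs , cong (x ∷_) e
  orderedPairs-precedes (x ∷ xs) uw∈ | inj₂ ∈₂ with orderedPairs-precedes xs ∈₂
  ...   | ws , ys , zs , e = x ∷ ws , ys , zs , cong (x ∷_) e

  orderedPairs-≢ : ∀ {u w xs} → Unique xs → (u , w) ∈ orderedPairs xs → u ≢ w
  orderedPairs-≢ {xs = x ∷ xs} (x∉ ∷ uniq) uw∈ with ∈-++⁻ (map (x ,_) xs) uw∈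
  ... | inj₁ ∈₁ with ∈-map⁻ (x ,_) ∈₁
  ...   | w , w∈ , refl = List.lookup x∉ w∈
  orderedPairs-≢ {xs = x ∷ xs} (x∉ ∷ uniq) uw∈ | inj₂ ∈₂ = orderedPairs-≢ uniq ∈₂

  orderedPairs-unique : ∀ {xs} → Unique xs → Unique (orderedPairs xs)
  orderedPairs-unique []                          = []
  orderedPairs-unique {x ∷ xs} (x∉ ∷ uniq) = Unique.++⁺
    (Unique.map⁺ (λ { refl → refl }) uniq) (orderedPairs-unique uniq) disjoint
    where
    disjoint : ∀ {v} → v ∈ map (x ,_) xs × v ∈ orderedPairs xs → ⊥
    disjoint (∈₁ , ∈₂) with ∈-map⁻ (x ,_) ∈₁
    ... | w , w∈ , refl = List.lookup x∉ (proj₁ (orderedPairs-∈ xs ∈₂)) refl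

length-concat-tabulate : ∀ {A : Set} {p} (f : Fin p → List A) →
                         length (concat (tabulate f)) ≡ sumℕ (λ i → length (f i))
length-concat-tabulate {p = zero}  f = refl
length-concat-tabulate {p = suc p} f = trans (length-++ (f zero))
  (cong (length (f zero) +_) (length-concat-tabulate (λ i → f (suc i))))

-- With b the whole sum, add 2(p f i)b ≤ (p f i)² + b² over all i; then p b² and a factor p cancel.
cauchy-schwarz : ∀ {p} (f : Fin p → ℕ) → sumℕ f * sumℕ f ≤ p * sumℕ (λ i → f i * f i)
cauchy-schwarz {zero}      f = z≤n
cauchy-schwarz {p@(suc _)} f = *-cancelˡ-≤ p (+-cancelʳ-≤ (p * (b * b)) _ _ (begin
  p * (b * b) + p * (b * b)                       ≡⟨ regroup₁ p b ⟩
  2 * b * p * b                                   ≡⟨ sum-*ˡ (2 * b * p) f ⟨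
  sumℕ (λ i → 2 * b * p * f i)                    ≡⟨ sum-cong (λ i → regroup₂ p b (f i)) ⟩
  sumℕ (λ i → 2 * (p * f i * b))                  ≤⟨ sum-mono (λ i → 2ab≤a²+b² (p * f i) b) ⟩
  sumℕ (λ i → p * f i * (p * f i) + b * b)        ≡⟨ sum-+ (λ i → p * f i * (p * f i)) (λ _ → b * b) ⟩
  sumℕ (λ i → p * f i * (p * f i)) + sumℕ {p} (λ _ → b * b)
    ≡⟨ cong₂ _+_ (trans (sum-cong (λ i → regroup₃ p (f i))) (sum-*ˡ (p * p) (λ i → f i * f i))) (sum-const p (b * b)) ⟩
  p * p * Q + p * (b * b)                         ≡⟨ cong (_+ p * (b * b)) (*-assoc p p Q) ⟩
  p * (p * Q) + p * (b * b)                       ∎))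
  where
  open ≤-Reasoning
  b = sumℕ f
  Q = sumℕ (λ i → f i * f i)
  regroup₁ : ∀ p b → p * (b * b) + p * (b * b) ≡ 2 * b * p * b
  regroup₁ = solve-∀
  regroup₂ : ∀ p b x → 2 * b * p * x ≡ 2 * (p * x * b)
  regroup₂ = solve-∀
  regroup₃ : ∀ p x → p * x * (p * x) ≡ p * p * (x * x)
  regroup₃ = solve-∀

module _ {n p} (S : PathSystem n p) (bridgeFree : BridgeFree S) where

  -- Two paths sharing an ordered pair form a 2-bridge.
  paths-disjoint : ∀ {i j} → i ≢ j →
    ∀ {v} → v ∈ orderedPairs (path S i) × v ∈ orderedPairs (path S j) → ⊥
  paths-disjoint {i} {j} i≢j {u , w} (∈i , ∈j) = bridgeFree 1 record
    { v = nodes ; π = paths ; v-inj = nodes-injective ; π-inj = paths-injective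
    ; chain = λ { zero → orderedPairs-precedes (path S i) ∈i }
    ; close = orderedPairs-precedes (path S j) ∈j }
    where
    u≢w = orderedPairs-≢ (distinct S i) ∈i
    nodes : Fin 2 → Fin n
    nodes zero       = u
    nodes (suc zero) = w
    paths : Fin 2 → Fin p
    paths zero       = i
    paths (suc zero) = j
    nodes-injective : ∀ {x y} → nodes x ≡ nodes y → x ≡ y
    nodes-injective {zero}     {zero}     e = refl
    nodes-injective {zero}     {suc zero} e = ⊥-elim (u≢w e)
    nodes-injective {suc zero} {zero}     e = ⊥-elim (u≢w (sym e))
    nodes-injective {suc zero} {suc zero} e = refl
    paths-injective : ∀ {x y} → paths x ≡ paths y → x ≡ y
    paths-injective {zero}     {zero}     e = refl
    paths-injective {zero}     {suc zero} e = ⊥-elim (i≢j e)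
    paths-injective {suc zero} {zero}     e = ⊥-elim (i≢j (sym e))
    paths-injective {suc zero} {suc zero} e = refl

  allPairs : List (Fin n × Fin n)
  allPairs = concat (tabulate (λ i → orderedPairs (path S i)))

  allPairs-length : length allPairs ≤ n * n
  allPairs-length = unique-pairs-length (Unique.concat⁺
    (List.tabulate⁺ (λ i → orderedPairs-unique (distinct S i)))
    (AllPairs.tabulate⁺ paths-disjoint))

  sum-squares : sumℕ (λ i → length (path S i) * length (path S i)) ≡ 2 * length allPairs + size S
  sum-squares = begin
    sumℕ (λ i → ℓ i * ℓ i)                ≡⟨ sum-cong (λ i → orderedPairs-length (path S i)) ⟨
    sumℕ (λ i → 2 * T i + ℓ i)            ≡⟨ sum-+ (λ i → 2 * T i) ℓ ⟩
    sumℕ (λ i → 2 * T i) + size S         ≡⟨ cong (_+ size S) (sum-*ˡ 2 T) ⟩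
    2 * sumℕ T + size S                   ≡⟨ cong (λ k → 2 * k + size S) (length-concat-tabulate (λ i → orderedPairs (path S i))) ⟨
    2 * length allPairs + size S          ∎
    where
    open ≡-Reasoning
    ℓ T : Fin p → ℕ
    ℓ i = length (path S i)
    T i = length (orderedPairs (path S i))

  -- Cauchy-Schwarz gives b² ≤ p(2T + b), where T ≤ n² counts the ordered pairs on all paths. If 2p
  -- ≤ b, the term pb is at most b²/2 and is absorbed on the left; otherwise b² ≤ 4p², and p ≤ n²
  -- finishes.
  size² : p ≤ n * n → size S * size S ≤ 4 * (n * n * p)
  size² p≤n² with ≤-total (size S) (2 * p)
  ... | inj₁ b≤2p = begin
    b * b               ≤⟨ *-mono-≤ b≤2p b≤2p ⟩
    2 * p * (2 * p)     ≡⟨ regroup p ⟩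
    4 * (p * p)         ≤⟨ *-monoʳ-≤ 4 (*-monoˡ-≤ p p≤n²) ⟩
    4 * (n * n * p)     ∎
    where
    open ≤-Reasoning
    b = size S
    regroup : ∀ p → 2 * p * (2 * p) ≡ 4 * (p * p)
    regroup = solve-∀
  ... | inj₂ 2p≤b = +-cancelʳ-≤ (b * b) _ _ (begin
    b * b + b * b                    ≡⟨ cong (b * b +_) (+-identityʳ (b * b)) ⟨
    2 * (b * b)                      ≤⟨ *-monoʳ-≤ 2 (cauchy-schwarz (λ i → length (path S i))) ⟩
    2 * (p * sumℕ (λ i → length (path S i) * length (path S i)))
                                     ≡⟨ cong (λ k → 2 * (p * k)) sum-squares ⟩
    2 * (p * (2 * T + b))            ≡⟨ regroup p T b ⟩
    4 * (T * p) + 2 * p * b          ≤⟨ +-mono-≤ (*-monoʳ-≤ 4 (*-monoˡ-≤ p allPairs-length)) (*-monoˡ-≤ b 2p≤b) ⟩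
    4 * (n * n * p) + b * b          ∎)
    where
    open ≤-Reasoning
    b = size S
    T = length allPairs
    regroup : ∀ p T b → 2 * (p * (2 * T + b)) ≡ 4 * (T * p) + 2 * p * b
    regroup = solve-∀

-- Induced matchings from spheres

funToFin-cong : ∀ {m n} {f g : Fin m → Fin n} → (∀ i → f i ≡ g i) → funToFin f ≡ funToFin g
funToFin-cong {zero}  h = refl
funToFin-cong {suc m} h = cong₂ combine (h zero) (funToFin-cong (λ i → h (suc i)))

‖_‖² : ∀ {m} → (Fin m → ℕ) → ℕ
‖ u ‖² = sumℕ (λ i → u i * u i)

-- A sphere contains no three-term progression u, v, w: the parallelogram law forces |u - w| = 0.
sphere-progression-free : ∀ {m} (u v w : Fin m → ℕ) → (∀ i → u i + w i ≡ 2 * v i) →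
  ‖ u ‖² ≡ ‖ w ‖² → ‖ v ‖² ≡ ‖ w ‖² → ∀ i → u i ≡ w i
sphere-progression-free u v w prog uw vw i = 2ab≡a²+b²⇒a≡b (u i) (w i)
  (sum-≤-≡ (λ i → 2ab≤a²+b² (u i) (w i)) (≤-reflexive norms≡) i)
  where
  open ≡-Reasoning
  N = ‖ w ‖²
  S = sumℕ (λ i → u i * u i + w i * w i)
  S≡ : S ≡ N + N
  S≡ = trans (sum-+ (λ i → u i * u i) (λ i → w i * w i)) (cong (_+ N) uw)
  double : ∀ x → 4 * x ≡ (x + x) + (x + x)
  double = solve-∀
  expand : ∀ a b → (a + b) * (a + b) ≡ 2 * (a * b) + (a * a + b * b)
  expand = solve-∀
  square : ∀ a → 4 * (a * a) ≡ (2 * a) * (2 * a)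
  square = solve-∀
  norms≡ : S ≡ sumℕ (λ i → 2 * (u i * w i))
  norms≡ = +-cancelʳ-≡ S _ _ (begin
    S + S                                                  ≡⟨ cong₂ _+_ S≡ S≡ ⟩
    (N + N) + (N + N)                                      ≡⟨ double N ⟨
    4 * N                                                  ≡⟨ cong (4 *_) vw ⟨
    4 * ‖ v ‖²                                             ≡⟨ sum-*ˡ 4 (λ i → v i * v i) ⟨
    sumℕ (λ i → 4 * (v i * v i))                           ≡⟨ sum-cong (λ i → trans (square (v i)) (cong (λ s → s * s) (sym (prog i)))) ⟩
    sumℕ (λ i → (u i + w i) * (u i + w i))                 ≡⟨ sum-cong (λ i → expand (u i) (w i)) ⟩
    sumℕ (λ i → 2 * (u i * w i) + (u i * u i + w i * w i)) ≡⟨ sum-+ (λ i → 2 * (u i * w i)) (λ i → u i * u i + w i * w i) ⟩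
    sumℕ (λ i → 2 * (u i * w i)) + S                       ∎)

module _ (m d Z : ℕ) (md²<Z : m * (d * d) < Z) where

  digit : Fin (d ^ m) → Fin m → ℕ
  digit x i = toℕ (finToFun {d} {m} x i)

  digit-injective : ∀ {x y} → (∀ i → digit x i ≡ digit y i) → x ≡ y
  digit-injective {x} {y} h = trans (sym (Fin.funToFin-finToFin {m} {d} x))
    (trans (funToFin-cong (λ i → Fin.toℕ-injective (h i))) (Fin.funToFin-finToFin {m} {d} y))

  digit≤ : ∀ x i → digit x i ≤ d
  digit≤ x i = <⇒≤ (Fin.toℕ<n (finToFun {d} {m} x i))

  ‖digit‖²<Z : ∀ u → ‖ digit u ‖² < Z
  ‖digit‖²<Z u = ≤-<-trans (≤-trans (sum-mono (λ i → *-mono-≤ (digit≤ u i) (digit≤ u i)))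
    (≤-reflexive (sum-const m (d * d)))) md²<Z

  -- c = 1 and c = 2 give the two sides of the graph.
  shifted< : ∀ {c} → c ≤ 3 → ∀ x u i → digit x i + c * digit u i < 4 * d
  shifted< c≤3 x u i = +-mono-<-≤ (Fin.toℕ<n (finToFun {d} {m} x i)) (*-mono-≤ c≤3 (digit≤ u i))

  -- The vector x + c u together with ‖u‖²; base 4d leaves room for every coordinate without a
  -- carry. Joining x + u to x + 2u, one matching for each x, is the Ruzsa-Szemerédi graph.
  slot : ∀ {c} → c ≤ 3 → Fin (d ^ m) → Fin (d ^ m) → Fin ((4 * d) ^ m * Z)
  slot c≤3 x u = combine (funToFin (λ i → fromℕ< (shifted< c≤3 x u i))) (fromℕ< (‖digit‖²<Z u))

  slot-injective : ∀ {c} (c≤3 : c ≤ 3) {x u z w} → slot c≤3 x u ≡ slot c≤3 z w →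
    (∀ i → digit x i + c * digit u i ≡ digit z i + c * digit w i) × ‖ digit u ‖² ≡ ‖ digit w ‖²
  slot-injective c≤3 {x} {u} {z} {w} e with Fin.combine-injective (vec x u) (fromℕ< (‖digit‖²<Z u)) (vec z w) (fromℕ< (‖digit‖²<Z w)) e
    where
    vec : Fin (d ^ m) → Fin (d ^ m) → Fin ((4 * d) ^ m)
    vec x u = funToFin (λ i → fromℕ< (shifted< c≤3 x u i))
  ... | e₁ , e₂ = (λ i → Fin.fromℕ<-injective _ _ (shifted< c≤3 x u i) (shifted< c≤3 z w i)
      (trans (sym (Fin.finToFun-funToFin _ i)) (trans (cong (λ v → finToFun {4 * d} {m} v i) e₁) (Fin.finToFun-funToFin _ i))))
    , Fin.fromℕ<-injective _ _ (‖digit‖²<Z u) (‖digit‖²<Z w) e₂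

  -- Behrend's construction, with the radius recorded in the node instead of fixed by pigeonhole.
  behrend : InducedMatchings (d ^ m) (d ^ m) ((4 * d) ^ m * Z)
  behrend = record { a = slot 1≤3 ; b = slot 2≤3 ; induced = induced }
    where
    1≤3 = s≤s {0} {2} z≤n
    2≤3 = s≤s (s≤s {0} {1} z≤n)
    induced : ∀ {x z u u′ w} → slot 1≤3 x u ≡ slot 1≤3 z w → slot 2≤3 x u′ ≡ slot 2≤3 z w → u ≡ u′ × x ≡ z
    induced {x} {z} {u} {u′} {w} ea eb with slot-injective 1≤3 {x} {u} {z} {w} ea | slot-injective 2≤3 {x} {u′} {z} {w} eb
    ... | sums₁ , norm₁ | sums₂ , norm₂ = digit-injective u≡u′ , digit-injective x≡z
      where
      -- From x + u = z + w and x + 2u′ = z + 2w, eliminating z - x makes u, u′, w a progression;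
      -- the recorded norms put all three on one sphere.
      prog : ∀ i → digit u i + digit w i ≡ 2 * digit u′ i
      prog i = +-cancelˡ-≡ (X + Z′) _ _ (begin
        (X + Z′) + (U + W)       ≡⟨ r₁ X Z′ U W ⟩
        (X + 1 * U) + (Z′ + W)   ≡⟨ cong (_+ (Z′ + W)) (sums₁ i) ⟩
        (Z′ + 1 * W) + (Z′ + W)  ≡⟨ r₂ Z′ W ⟩
        Z′ + (Z′ + 2 * W)        ≡⟨ cong (Z′ +_) (sums₂ i) ⟨
        Z′ + (X + 2 * U′)        ≡⟨ r₃ X Z′ U′ ⟩
        (X + Z′) + 2 * U′        ∎)
        where
        open ≡-Reasoning
        X = digit x i
        Z′ = digit z i
        U = digit u i
        U′ = digit u′ i
        W = digit w i
        r₁ : ∀ X Z U W → (X + Z) + (U + W) ≡ (X + 1 * U) + (Z + W)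
        r₁ = solve-∀
        r₂ : ∀ Z W → (Z + 1 * W) + (Z + W) ≡ Z + (Z + 2 * W)
        r₂ = solve-∀
        r₃ : ∀ X Z U → Z + (X + 2 * U) ≡ (X + Z) + 2 * U
        r₃ = solve-∀
      u≡w : ∀ i → digit u i ≡ digit w i
      u≡w = sphere-progression-free (digit u) (digit u′) (digit w) prog norm₁ norm₂
      u≡u′ : ∀ i → digit u i ≡ digit u′ i
      u≡u′ i = *-cancelˡ-≡ (digit u i) (digit u′ i) 2 (trans (cong (digit u i +_) (trans (+-identityʳ _) (u≡w i))) (prog i))
      x≡z : ∀ i → digit x i ≡ digit z i
      x≡z i = +-cancelʳ-≡ (1 * digit w i) _ _ (trans (cong (λ k → digit x i + 1 * k) (sym (u≡w i))) (sums₁ i))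

-- Choice of parameters

2^-mono : ∀ {a b} → a ≤ b → 2 ^ a ≤ 2 ^ b
2^-mono = ^-monoʳ-≤ 2

n<2^n : ∀ n → n < 2 ^ n
n<2^n zero    = s≤s z≤n
n<2^n (suc n) = begin
  suc (suc n)       ≤⟨ s≤s (n<2^n n) ⟩
  1 + 2 ^ n         ≤⟨ +-monoˡ-≤ (2 ^ n) (m^n>0 2 n) ⟩
  2 ^ n + 2 ^ n     ≡⟨ cong (2 ^ n +_) (+-identityʳ (2 ^ n)) ⟨
  2 ^ suc n         ∎
  where open ≤-Reasoning

^-distribʳ-* : ∀ k m n → (m * n) ^ k ≡ m ^ k * n ^ k
^-distribʳ-* zero    m n = refl
^-distribʳ-* (suc k) m n = trans (cong (m * n *_) (^-distribʳ-* k m n)) (interchange m n (m ^ k) (n ^ k))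
  where
  interchange : ∀ a b c d → a * b * (c * d) ≡ a * c * (b * d)
  interchange = solve-∀

-- log₂ of a number of nodes that suffices for Behrend's construction with m digits below 2^m
logNodes : ℕ → ℕ
logNodes m = m * m + 5 * m + 3

private
  -- Lets Z = d³ exceed all squared norms for d = 2^m while remaining a power of two.
  m[2^m]²<[2^m]³ : ∀ m → m * (2 ^ m * 2 ^ m) < 2 ^ m * (2 ^ m * 2 ^ m)
  m[2^m]²<[2^m]³ m = *-monoˡ-< (2 ^ m * 2 ^ m) {{m*n≢0 (2 ^ m) (2 ^ m) {{m^n≢0 2 m}} {{m^n≢0 2 m}}}} (n<2^n m)

module _ (m : ℕ) where

  private
    d D F K : ℕ
    d = 2 ^ m
    D = 2 ^ (m * m)
    F = 2 ^ (5 * m)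
    K = (4 * d) ^ m * (d * (d * d))

    d^m≡D : d ^ m ≡ D
    d^m≡D = ^-*-assoc 2 m m

    K≡DF : K ≡ D * F
    K≡DF = begin
      (4 * 2 ^ m) ^ m * (2 ^ m * (2 ^ m * 2 ^ m))
        ≡⟨ cong₂ _*_ (trans (cong (_^ m) (sym (^-distribˡ-+-* 2 2 m))) (^-*-assoc 2 (2 + m) m))
             (sym (trans (^-distribˡ-+-* 2 m (m + m)) (cong (2 ^ m *_) (^-distribˡ-+-* 2 m m)))) ⟩
      2 ^ ((2 + m) * m) * 2 ^ (m + (m + m))   ≡⟨ ^-distribˡ-+-* 2 ((2 + m) * m) (m + (m + m)) ⟨
      2 ^ ((2 + m) * m + (m + (m + m)))       ≡⟨ cong (2 ^_) (exponent m) ⟩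
      2 ^ (m * m + 5 * m)                     ≡⟨ ^-distribˡ-+-* 2 (m * m) (5 * m) ⟩
      D * F                                   ∎
      where
      open ≡-Reasoning
      exponent : ∀ m → (2 + m) * m + (m + (m + m)) ≡ m * m + 5 * m
      exponent = solve-∀

    D≤K : D ≤ K
    D≤K = subst (D ≤_) (sym K≡DF) (m≤m*n D F {{m^n≢0 2 (5 * m)}})

    8K≡ : 8 * K ≡ 2 ^ logNodes m
    8K≡ = trans (cong (8 *_) K≡DF) (sym (begin
      2 ^ (m * m + 5 * m + 3)     ≡⟨ ^-distribˡ-+-* 2 (m * m + 5 * m) 3 ⟩
      2 ^ (m * m + 5 * m) * 8     ≡⟨ *-comm (2 ^ (m * m + 5 * m)) 8 ⟩
      8 * 2 ^ (m * m + 5 * m)     ≡⟨ cong (8 *_) (^-distribˡ-+-* 2 (m * m) (5 * m)) ⟩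
      8 * (D * F)                 ∎))
      where open ≡-Reasoning

    -- The inequality of `gap` with p = σ = D and K = DF: a factor D² cancels, and the loss F² =
    -- 2^(10m) is the origin of the 10 in `logGap`.
    cancel-D : ∀ k → D * (D * D) ≤ k * k * (K * K) → D ≤ k * k * 2 ^ (10 * m)
    cancel-D k h = *-cancelʳ-≤ D _ (D * D) {{m*n≢0 D D {{m^n≢0 2 (m * m)}} {{m^n≢0 2 (m * m)}}}} (begin
      D * (D * D)                      ≤⟨ h ⟩
      k * k * (K * K)                  ≡⟨ cong (λ K → k * k * (K * K)) K≡DF ⟩
      k * k * (D * F * (D * F))        ≡⟨ regroup (k * k) D F ⟩
      k * k * (F * F) * (D * D)        ≡⟨ cong (λ f → k * k * f * (D * D))
                                            (trans (sym (^-distribˡ-+-* 2 (5 * m) (5 * m))) (cong (2 ^_) (exponent m))) ⟩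
      k * k * 2 ^ (10 * m) * (D * D)   ∎)
      where
      open ≤-Reasoning
      regroup : ∀ c D F → c * (D * F * (D * F)) ≡ c * (F * F) * (D * D)
      regroup = solve-∀
      exponent : ∀ m → 5 * m + 5 * m ≡ 10 * m
      exponent = solve-∀

  -- Surplus nodes become pad nodes and surplus demands become padding. There are at least 2^(m²)
  -- pad nodes, each with n possible targets, hence the upper limit on p.
  gap-at : ∀ {n p k} → 2 ^ logNodes m ≤ n → 2 ^ (m * m) ≤ p → p ≤ n * 2 ^ (m * m) →
           GapBound n p k → 2 ^ (m * m) ≤ k * k * 2 ^ (10 * m)
  gap-at {n} {p} {k} 2^≤n D≤p p≤nD bound = cancel-D k
    (subst (λ D → D * (D * D) ≤ k * k * (K * K)) d^m≡D
      (Instance.gap q {{nonZero}} (behrend m d (d * (d * d)) (m[2^m]²<[2^m]³ m)) r r≤ k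
        (subst (λ n → GapBound n (d ^ m + r) k) (sym nodes≡) (subst (λ p → GapBound n p k) (sym demands≡) bound))))
    where
    nonZero : NonZero (d ^ m)
    nonZero = m^n≢0 d m {{m^n≢0 2 m}}
    base = d ^ m + (d ^ m + (K + (K + (K + K))))
    q r : ℕ
    q = n ∸ base
    r = p ∸ d ^ m
    -- Sources, sinks and split slots take at most 6K nodes, so 8K leave 2K for the padding.
    base+2K≤n : base + 2 * K ≤ n
    base+2K≤n = begin
      base + 2 * K                                ≤⟨ +-monoˡ-≤ (2 * K) (+-mono-≤ d^m≤K (+-monoˡ-≤ (K + (K + (K + K))) d^m≤K)) ⟩
      K + (K + (K + (K + (K + K)))) + 2 * K       ≡⟨ total K ⟩
      8 * K                                       ≡⟨ 8K≡ ⟩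
      2 ^ logNodes m                              ≤⟨ 2^≤n ⟩
      n                                           ∎
      where
      open ≤-Reasoning
      d^m≤K : d ^ m ≤ K
      d^m≤K = subst (_≤ K) (sym d^m≡D) D≤K
      total : ∀ K → K + (K + (K + (K + (K + K)))) + 2 * K ≡ 8 * K
      total = solve-∀
    D≤q : D ≤ q
    D≤q = ≤-trans D≤K (≤-trans (m≤m+n K (K + 0)) (m+n≤o⇒m≤o∸n (2 * K) (subst (_≤ n) (+-comm base (2 * K)) base+2K≤n)))
    nodes≡ : d ^ m + (d ^ m + (K + (K + (K + (K + q))))) ≡ n
    nodes≡ = trans (assoc (d ^ m) K q) (m+[n∸m]≡n (m+n≤o⇒m≤o base base+2K≤n))
      where
      assoc : ∀ D K q → D + (D + (K + (K + (K + (K + q))))) ≡ D + (D + (K + (K + (K + K)))) + q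
      assoc = solve-∀
    demands≡ : d ^ m + r ≡ p
    demands≡ = m+[n∸m]≡n (subst (_≤ p) (sym d^m≡D) D≤p)
    r≤ : r ≤ q * (d ^ m + (d ^ m + (K + (K + (K + (K + q))))))
    r≤ = begin
      p ∸ d ^ m     ≤⟨ m∸n≤m p (d ^ m) ⟩
      p             ≤⟨ p≤nD ⟩
      n * D         ≤⟨ *-monoʳ-≤ n D≤q ⟩
      n * q         ≡⟨ *-comm n q ⟩
      q * n         ≡⟨ cong (q *_) nodes≡ ⟨
      q * (d ^ m + (d ^ m + (K + (K + (K + (K + q)))))) ∎
      where open ≤-Reasoning

-- log₂ of the gap² of the instance with parameter m; zero for m ≤ 10
logGap : ℕ → ℕ
logGap m = m * m ∸ 10 * m

2^a≤c*2^b⇒2^[a∸b]≤c : ∀ a b c → 2 ^ a ≤ c * 2 ^ b → 2 ^ (a ∸ b) ≤ c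
2^a≤c*2^b⇒2^[a∸b]≤c a b zero    h = ⊥-elim (<⇒≱ (m^n>0 2 a) h)
2^a≤c*2^b⇒2^[a∸b]≤c a b (suc c) h with ≤-total a b
... | inj₁ a≤b = subst (λ e → 2 ^ e ≤ suc c) (sym (m≤n⇒m∸n≡0 a≤b)) (s≤s z≤n)
... | inj₂ b≤a = *-cancelʳ-≤ (2 ^ (a ∸ b)) (suc c) (2 ^ b) {{m^n≢0 2 b}}
  (subst (_≤ suc c * 2 ^ b) (trans (cong (2 ^_) (sym (m∸n+n≡m b≤a))) (^-distribˡ-+-* 2 (a ∸ b) b)) h)

gap-logGap : ∀ m {n p k} → 2 ^ logNodes m ≤ n → 2 ^ (m * m) ≤ p → p ≤ n * 2 ^ (m * m) →
             GapBound n p k → 2 ^ logGap m ≤ k * k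
gap-logGap m {k = k} h₁ h₂ h₃ bound =
  2^a≤c*2^b⇒2^[a∸b]≤c (m * m) (10 * m) (k * k) (gap-at m {k = k} h₁ h₂ h₃ bound)

-- the largest m with 2 ^ logNodes m ≤ n, provided 8 ≤ n
level : ℕ → ℕ
level zero    = 0
level (suc n) with 2 ^ logNodes (suc (level n)) ≤? suc n
... | yes _ = suc (level n)
... | no _  = level n

logNodes-mono : ∀ {a b} → a ≤ b → logNodes a ≤ logNodes b
logNodes-mono a≤b = +-monoˡ-≤ 3 (+-mono-≤ (*-mono-≤ a≤b a≤b) (*-monoʳ-≤ 5 a≤b))

level-lower : ∀ n → 8 ≤ n → 2 ^ logNodes (level n) ≤ n
level-lower n 8≤n with invariant n
  where
  invariant : ∀ n → level n ≡ 0 ⊎ 2 ^ logNodes (level n) ≤ n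
  invariant zero = inj₁ refl
  invariant (suc n) with 2 ^ logNodes (suc (level n)) ≤? suc n
  ... | yes le = inj₂ le
  ... | no _ with invariant n
  ...   | inj₁ e  = inj₁ e
  ...   | inj₂ le = inj₂ (m≤n⇒m≤1+n le)
-- 8 is `2 ^ logNodes 0`.
... | inj₁ e  = subst (λ m → 2 ^ logNodes m ≤ n) (sym e) 8≤n
... | inj₂ le = le

level-upper : ∀ n → n < 2 ^ logNodes (suc (level n))
level-upper zero = s≤s z≤n
level-upper (suc n) with 2 ^ logNodes (suc (level n)) ≤? suc n
... | no ≰  = ≰⇒> ≰
... | yes _ = ≤-<-trans (level-upper n) (^-monoʳ-< 2 (s≤s (s≤s z≤n)) (+-monoˡ-< 3 (+-mono-<-≤
  (*-mono-< (n<1+n (suc (level n))) (n<1+n (suc (level n)))) (*-monoʳ-≤ 5 (n≤1+n (suc (level n)))))))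

level-unbounded : ∀ M n → 2 ^ logNodes M ≤ n → M ≤ level n
level-unbounded M n le = ≮⇒≥ λ lt →
  <⇒≱ (level-upper n) (≤-trans (2^-mono (logNodes-mono lt)) le)

-- Zero below 8 nodes, where no instance fits: DSFG(1,1) = 0 although β(1,1,∞) = 1.
R : ℕ → ℕ
R n with 8 ≤? n
... | yes _ = n * 2 ^ logGap (level n)
... | no _  = 0

R≡ : ∀ {n} → 8 ≤ n → R n ≡ n * 2 ^ logGap (level n)
R≡ {n} 8≤n with 8 ≤? n
... | yes _ = refl
... | no ≰  = ⊥-elim (≰ 8≤n)

1≤R⇒8≤n : ∀ {n} → 1 ≤ R n → 8 ≤ n
1≤R⇒8≤n {n} 1≤R with 8 ≤? n
... | yes le = le

logGap≤m² : ∀ m → logGap m ≤ m * m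
logGap≤m² m = m∸n≤m (m * m) (10 * m)

m²≤logNodes : ∀ m → m * m ≤ logNodes m
m²≤logNodes m = ≤-trans (m≤m+n (m * m) (5 * m)) (m≤m+n (m * m + 5 * m) 3)

R≤n² : ∀ n → R n ≤ n * n
R≤n² n with 8 ≤? n
... | no _    = z≤n
... | yes 8≤n = *-monoʳ-≤ n (≤-trans (2^-mono (≤-trans (logGap≤m² (level n)) (m²≤logNodes (level n))))
  (level-lower n 8≤n))

-- abstract, so that 2 ^ logNodes (minLevel i) is never unfolded
abstract

  minLevel : ℕ → ℕ
  minLevel i = 10 + 26 * i

  -- As `logNodes (suc m)` is m² + 7m + 9 and `logGap m` is m² - 10m, the claim amounts to 17mi + 9i
  -- + 10m ≤ m². Bounding 9i by 9mi leaves m ≥ 10 + 26i, the value of `minLevel`.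
  logNodes*i≤logGap*j : ∀ i m → minLevel i ≤ m → logNodes (suc m) * i ≤ logGap m * suc i
  logNodes*i≤logGap*j i m le = subst (logNodes (suc m) * i ≤_) (sym (*-distribʳ-∸ (suc i) (m * m) (10 * m)))
    (m+n≤o⇒m≤o∸n (logNodes (suc m) * i) (begin
      (suc m * suc m + 5 * suc m + 3) * i + 10 * m * suc i      ≡⟨ expand i m ⟩
      (17 * (m * i) + 10 * m + m * m * i) + 9 * (1 * i)         ≤⟨ +-monoʳ-≤ (17 * (m * i) + 10 * m + m * m * i) (*-monoʳ-≤ 9 (*-monoˡ-≤ i 1≤m)) ⟩
      (17 * (m * i) + 10 * m + m * m * i) + 9 * (m * i)         ≡⟨ collect i m ⟩
      m * (10 + 26 * i) + m * m * i                             ≤⟨ +-monoˡ-≤ (m * m * i) (*-monoʳ-≤ m le) ⟩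
      m * m + m * m * i                                         ≡⟨ *-suc (m * m) i ⟨
      m * m * suc i                                             ∎))
    where
    open ≤-Reasoning
    1≤m : 1 ≤ m
    1≤m = ≤-trans (s≤s z≤n) le
    expand : ∀ i m → (suc m * suc m + 5 * suc m + 3) * i + 10 * m * suc i
                   ≡ (17 * (m * i) + 10 * m + m * m * i) + 9 * (1 * i)
    expand = solve-∀
    collect : ∀ i m → (17 * (m * i) + 10 * m + m * m * i) + 9 * (m * i) ≡ m * (10 + 26 * i) + m * m * i
    collect = solve-∀

threshold : ℕ → ℕ
threshold i = 2 ^ logNodes (minLevel i)

8≤threshold : ∀ i → 8 ≤ threshold i
8≤threshold i = lemma (minLevel i)
  where
  lemma : ∀ m → 2 ^ 3 ≤ 2 ^ logNodes m
  lemma m = 2^-mono (m≤n+m 3 (m * m + 5 * m))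

-- The squared gap is n^(1 - o(1)): it is at least n^(i/(i+1)) for every fixed i and large n. Since
-- n lies below the size required by the next level, comparing the exponents of two consecutive
-- levels is enough.
power≤2^logGap : ∀ i n → threshold i ≤ n → n ^ i ≤ (2 ^ logGap (level n)) ^ suc i
power≤2^logGap i n N≤n = begin
  n ^ i                              ≤⟨ ^-monoˡ-≤ i (<⇒≤ (level-upper n)) ⟩
  (2 ^ logNodes (suc μ)) ^ i         ≡⟨ ^-*-assoc 2 (logNodes (suc μ)) i ⟩
  2 ^ (logNodes (suc μ) * i)         ≤⟨ 2^-mono (logNodes*i≤logGap*j i μ (level-unbounded (minLevel i) n N≤n)) ⟩
  2 ^ (logGap μ * suc i)             ≡⟨ ^-*-assoc 2 (logGap μ) (suc i) ⟨
  (2 ^ logGap μ) ^ suc i             ∎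
  where
  open ≤-Reasoning
  μ = level n

R-large : ∀ j → 1 ≤ j → Σ ℕ λ N → ∀ n → N ≤ n → n ^ (2 * j ∸ 1) ≤ R n ^ j
R-large (suc i) _ = threshold i , λ n N≤n → begin
  n ^ (i + (suc i + 0))                       ≡⟨ cong (λ j → n ^ (i + j)) (+-identityʳ (suc i)) ⟩
  n ^ (i + suc i)                             ≡⟨ ^-distribˡ-+-* n i (suc i) ⟩
  n ^ i * n ^ suc i                           ≡⟨ *-comm (n ^ i) (n ^ suc i) ⟩
  n ^ suc i * n ^ i                           ≤⟨ *-monoʳ-≤ (n ^ suc i) (power≤2^logGap i n N≤n) ⟩
  n ^ suc i * (2 ^ logGap (level n)) ^ suc i  ≡⟨ ^-distribʳ-* (suc i) n (2 ^ logGap (level n)) ⟨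
  (n * 2 ^ logGap (level n)) ^ suc i          ≡⟨ cong (_^ suc i) (R≡ (≤-trans (8≤threshold i) N≤n)) ⟨
  R n ^ suc i                                 ∎
  where open ≤-Reasoning

-- The gap against the number of demands and against β

gap-level : ∀ {n p k} → 8 ≤ n → n ≤ p → p ≤ R n → GapBound n p k → 2 ^ logGap (level n) ≤ k * k
gap-level {n} {p} {k} 8≤n n≤p p≤R = gap-logGap (level n) {k = k} (level-lower n 8≤n)
  (≤-trans (2^-mono (m²≤logNodes (level n))) (≤-trans (level-lower n 8≤n) n≤p))
  (≤-trans p≤R (≤-trans (≤-reflexive (R≡ 8≤n)) (*-monoʳ-≤ n (2^-mono (logGap≤m² (level n))))))

-- For p ≤ n this only asks for k ≥ 1, which the instance with m = 0 supplies. For larger p the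
-- instance of `level n` fits, and its squared gap is the factor by which `R n` exceeds n.
demands≤n*gap² : ∀ {n p k} → 1 ≤ p → p ≤ R n → GapBound n p k → p ≤ n * (k * k)
demands≤n*gap² {n} {p} {k} 1≤p p≤R bound with ≤-total p n
... | inj₁ p≤n = ≤-trans p≤n (≤-trans (≤-reflexive (sym (*-identityʳ n))) (*-monoʳ-≤ n
  (gap-logGap 0 {k = k} (1≤R⇒8≤n (≤-trans 1≤p p≤R)) 1≤p (≤-trans p≤n (≤-reflexive (sym (*-identityʳ n)))) bound)))
... | inj₂ n≤p = ≤-trans p≤R (≤-trans (≤-reflexive (R≡ 8≤n)) (*-monoʳ-≤ n (gap-level {k = k} 8≤n n≤p p≤R bound)))
  where
  8≤n = 1≤R⇒8≤n (≤-trans 1≤p p≤R)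

β²≤4k²n³ : ∀ {n p k b} → 1 ≤ p → p ≤ R n → IsDSFG n p k → IsBeta n p b → b * b ≤ 4 * (k * k * n ^ 3)
β²≤4k²n³ {n} {p} {k} 1≤p p≤R (bound , _) ((S , bridgeFree , refl) , _) = begin
  size S * size S                ≤⟨ size² S bridgeFree (≤-trans p≤R (R≤n² n)) ⟩
  4 * (n * n * p)                ≤⟨ *-monoʳ-≤ 4 (*-monoʳ-≤ (n * n) (demands≤n*gap² {k = k} 1≤p p≤R bound)) ⟩
  4 * (n * n * (n * (k * k)))    ≡⟨ regroup n k ⟩
  4 * (k * k * n ^ 3)            ∎
  where
  open ≤-Reasoning
  regroup : ∀ n k → 4 * (n * n * (n * (k * k))) ≡ 4 * (k * k * (n * (n * (n * 1))))
  regroup = solve-∀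

quarter-≤ : ∀ {a c} → a ≤ 4 * c → (½ ℚ.* ½) ℚ.* ℕ→ℚ a ℚ.≤ ℕ→ℚ c
quarter-≤ {a} {c} le = begin
  (½ ℚ.* ½) ℚ.* ℕ→ℚ a              ≤⟨ ℚ.*-monoˡ-≤-nonNeg (½ ℚ.* ½) (ℕ→ℚ-mono le) ⟩
  (½ ℚ.* ½) ℚ.* ℕ→ℚ (4 * c)        ≡⟨ cong ((½ ℚ.* ½) ℚ.*_) (ℕ→ℚ-* 4 c) ⟩
  (½ ℚ.* ½) ℚ.* (ℕ→ℚ 4 ℚ.* ℕ→ℚ c)  ≡⟨ ℚ.*-assoc (½ ℚ.* ½) (ℕ→ℚ 4) (ℕ→ℚ c) ⟨
  1ℚ ℚ.* ℕ→ℚ c                     ≡⟨ ℚ.*-identityˡ (ℕ→ℚ c) ⟩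
  ℕ→ℚ c                            ∎
  where open ℚ.≤-Reasoning

mainTheorem12 : Σ (ℕ → ℕ) λ R →
    (∀ n → R n ≤ n * n) ×
    (∀ j → 1 ≤ j → Σ ℕ λ N → ∀ n → N ≤ n → n ^ (2 * j ∸ 1) ≤ R n ^ j) ×
    (Σ ℚ λ c → (0ℚ ℚ.< c) ×
    (∀ n p k b → 1 ≤ p → p ≤ R n → IsDSFG n p k → IsBeta n p b →
    (c ℚ.* c) ℚ.* (ℕ→ℚ b ℚ.* ℕ→ℚ b)
    ℚ.≤ (ℕ→ℚ k ℚ.* ℕ→ℚ k) ℚ.* ℕ→ℚ (n ^ 3))) ×
    (∀ j → 1 ≤ j → Σ ℕ λ N → ∀ n k → N ≤ n → IsDSFG n (R n) k →
    n ^ (j ∸ 2) ≤ k ^ (2 * j))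
mainTheorem12 = R , R≤n² , R-large , (½ , from-yes (0ℚ ℚ.<? ½) , ratio) , gap-large
  where
  ratio : ∀ n p k b → 1 ≤ p → p ≤ R n → IsDSFG n p k → IsBeta n p b →
    (½ ℚ.* ½) ℚ.* (ℕ→ℚ b ℚ.* ℕ→ℚ b) ℚ.≤ (ℕ→ℚ k ℚ.* ℕ→ℚ k) ℚ.* ℕ→ℚ (n ^ 3)
  ratio n p k b 1≤p p≤R dsfg beta = subst₂ (λ u v → (½ ℚ.* ½) ℚ.* u ℚ.≤ v) (ℕ→ℚ-* b b)
    (trans (ℕ→ℚ-* (k * k) (n ^ 3)) (cong (ℚ._* ℕ→ℚ (n ^ 3)) (ℕ→ℚ-* k k)))
    (quarter-≤ {b * b} {k * k * n ^ 3} (β²≤4k²n³ {k = k} 1≤p p≤R dsfg beta))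
  gap-large : ∀ j → 1 ≤ j → Σ ℕ λ N → ∀ n k → N ≤ n → IsDSFG n (R n) k → n ^ (j ∸ 2) ≤ k ^ (2 * j)
  gap-large (suc i) _ = threshold i , λ n k N≤n dsfg →
    let 8≤n = ≤-trans (8≤threshold i) N≤n
        1≤n = ≤-trans (s≤s z≤n) 8≤n
        n≤R = ≤-trans (m≤m*n n (2 ^ logGap (level n)) {{m^n≢0 2 (logGap (level n))}}) (≤-reflexive (sym (R≡ 8≤n)))
    in begin
      -- The estimate below gives k^(2j) ≥ n^(j - 1), that is k ≥ n^(1/2 - 1/(2j)); at most one
      -- power of n is given away here.
      n ^ (i ∸ 1)                        ≤⟨ ^-monoʳ-≤ n {{ℕ.>-nonZero 1≤n}} (m∸n≤m i 1) ⟩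
      n ^ i                              ≤⟨ power≤2^logGap i n N≤n ⟩
      (2 ^ logGap (level n)) ^ suc i     ≤⟨ ^-monoˡ-≤ (suc i) (gap-level {k = k} 8≤n n≤R ≤-refl (proj₁ dsfg)) ⟩
      (k * k) ^ suc i                    ≡⟨ cong (λ s → (k * s) ^ suc i) (*-identityʳ k) ⟨
      (k ^ 2) ^ suc i                    ≡⟨ ^-*-assoc k 2 (suc i) ⟩
      k ^ (2 * suc i)                    ∎
    where open ≤-Reasoning
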